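{- Let $\mathbb{F}_q$ be a finite field with $q$ elements. Let $\lambda/\mu$ be a skew partition, and let $a \in \mathbb{F}_q$. Then $$P\left(s_{\lambda/\mu} \mapsto a\right) = P\left(s_{\lambda^{t}/\mu^{t}} \mapsto a\right),$$ where $\lambda^t$ and $\mu^t$ denote the conjugate partitions of $\lambda$ and $\mu$.
   Context: A partition is a weakly decreasing finite sequence of positive integers $\lambda = (\lambda_1, \ldots, \lambda_k)$; its length is $\ell(\lambda) = k$, and one sets $\lambda_i := 0$ for $i > k$. Its Young diagram is $Y(\lambda) = \{(i,j) : 1 \leq i \leq k,\ 1 \leq j \leq \lambda_i\}$. The conjugate $\lambda^t$ is the partition whose Young diagram is $\{(j,i) : (i,j) \in Y(\lambda)\}$. A skew partition $\lambda/\mu$ is a pair of partitions with $\mu_i \leq \lambda_i$ for all $i \geq 1$. Let $\mathcal{P} = \mathbb{Z}[h_1, h_2, h_3, \ldots]$ be the polynomial ring, with $h_0 := 1$ and $h_m := 0$ for $m < 0$. For a skew partition $\lambda/\mu$ with $k = \ell(\lambda)$, the skew Schur function is $s_{\lambda/\mu} := \det\left( h_{\lambda_i - \mu_j - i + j} \right)_{1 \leq i,j \leq k} \in \mathcal{P}$. For $f \in \mathcal{P}$ and $a \in \mathbb{F}_q$, choose $N$ such that $f$ involves only $h_1, \ldots, h_N$; then $$P(f \mapsto a) := \frac{\#\{(z_1, \ldots, z_N) \in \mathbb{F}_q^N \mid f(z_1, \ldots, z_N) = a\}}{q^N},$$ where the integer coefficients of $f$ are mapped to $\mathbb{F}_q$.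 This does not depend on the choice of $N$. -}

module Defs where

open import Algebra.Bundles using (CommutativeRing; Semiring)
import Algebra.Consequences.Setoid as Consequences
import Algebra.Definitions.RawSemiring as RawSemiringDefinitions
open import Data.Empty using (⊥-elim)
open import Data.Fin.Base using (Fin; zero; suc; toℕ; fromℕ; inject≤; punchIn)
open import Data.Fin.Properties using (nonZeroIndex; toℕ-fromℕ; toℕ-inject≤) renaming (_≟_ to _≟ᶠ_)
open import Data.Integer.Base as ℤ using (ℤ; +_; -[1+_]; 0ℤ; 1ℤ)
open import Data.List.Base using (List; []; _∷_; [_]; length; filter; map; allFin; applyUpTo; cartesianProductWith)
open import Data.List.Properties using (filter-accept; filter-reject)
open import Data.List.Relation.Unary.All using (All)
open import Data.List.Relation.Unary.All.Properties using () renaming (applyUpTo⁺₁ to All-applyUpTo⁺)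
open import Data.List.Relation.Unary.Linked as Linked using (Linked; []; [-]; _∷_)
open import Data.List.Relation.Unary.Linked.Properties using () renaming (applyUpTo⁺₂ to Linked-applyUpTo⁺)
open import Data.Nat.Base as ℕ using (ℕ; zero; suc; _≤_; _<_; _≥_; z≤n; s≤s; _⊔_; NonZero)
open import Data.Nat.Properties
  using (m^n≢0; _<?_; <-irrefl; <-≤-trans; ≤-refl; ≤-trans; n≤1+n; m≤m⊔n; m≤n⊔m)
open import Data.Product.Base using (∃; _,_)
open import Data.Rational.Base as ℚ using (ℚ)
open import Data.Vec.Base using (Vec; []; _∷_; lookup)
open import Function.Base using (_∘_)
open import Function.Bundles using (Inverse; _⇔_; mk⇔; Equivalence)
open import Function.Properties.Inverse using (Inverse⇒Injection)
import Level
open import Relation.Binary.Bundles using (Setoid)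
open import Relation.Binary.Definitions using (Decidable)
open import Relation.Binary.PropositionalEquality as ≡ using (_≡_; refl)
open import Relation.Binary.Structures using (IsEquivalence)
open import Relation.Nullary.Decidable using (yes; no; via-injection)
open import Relation.Nullary.Negation using (¬_; contradiction)

-- Rows and columns are indexed from 0: `part σ i` is σᵢ₊₁, and it is 0
-- beyond the length.

nth : List ℕ → ℕ → ℕ
nth []       _       = 0
nth (p ∷ ps) zero    = p
nth (p ∷ ps) (suc i) = nth ps i

record Partition : Set where
  field
    parts      : List ℕ
    decreasing : Linked _≥_ parts
    positive   : All (0 <_) parts

open Partition public

part : Partition → ℕ → ℕ
part σ = nth (parts σ)

ℓ : Partition → ℕ
ℓ σ = length (parts σ)

Y : Partition → ℕ → ℕ → Set
Y σ i j = j < part σ i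

column : List ℕ → ℕ → ℕ
column ps j = length (filter (j <?_) ps)

nth-head : ∀ {p ps} → Linked _≥_ (p ∷ ps) → ∀ i → nth (p ∷ ps) i ≤ p
nth-head _           zero    = ≤-refl
nth-head [-]         (suc i) = z≤n
nth-head (q≤p ∷ qs)  (suc i) = ≤-trans (nth-head qs i) q≤p

column-accept : ∀ {p ps j} → j < p → column (p ∷ ps) j ≡ suc (column ps j)
column-accept {j = j} j<p = ≡.cong length (filter-accept (j <?_) j<p)

column-reject : ∀ {p ps j} → Linked _≥_ (p ∷ ps) → ¬ (j < p) → column (p ∷ ps) j ≡ 0
column-reject {j = j} [-] j≮p = ≡.cong length (filter-reject (j <?_) j≮p)
column-reject {j = j} (q≤p ∷ qs) j≮p = ≡.trans
  (≡.cong length (filter-reject (j <?_) j≮p))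
  (column-reject qs (λ j<q → j≮p (<-≤-trans j<q q≤p)))

column⁺ : ∀ {ps} → Linked _≥_ ps → ∀ i j → j < nth ps i → i < column ps j
column⁺ {p ∷ ps} l i j j<σᵢ = ≡.subst (i <_) (≡.sym (column-accept j<p)) (go i j<σᵢ)
  where
  j<p = <-≤-trans j<σᵢ (nth-head l i)
  go : ∀ i → j < nth (p ∷ ps) i → i < suc (column ps j)
  go zero    _ = s≤s z≤n
  go (suc i) y = s≤s (column⁺ (Linked.tail l) i j y)

column⁻ : ∀ {ps} → Linked _≥_ ps → ∀ i j → i < column ps j → j < nth ps i
column⁻ {p ∷ ps} l i j i<c with j <? p
... | no j≮p = contradiction (≡.subst (i <_) (column-reject l j≮p) i<c) λ ()
... | yes j<p = go i (≡.subst (i <_) (column-accept j<p) i<c)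
  where
  go : ∀ i → i < suc (column ps j) → j < nth (p ∷ ps) i
  go zero    _         = j<p
  go (suc i) (s≤s i<c) = column⁻ (Linked.tail l) i j i<c

≤-from-< : ∀ {m n} → (∀ i → i < m → i < n) → m ≤ n
≤-from-< {zero}  f = z≤n
≤-from-< {suc m} f = f m ≤-refl

nth-applyUpTo : ∀ f n → (∀ j → n ≤ j → f j ≡ 0) → ∀ j → nth (applyUpTo f n) j ≡ f j
nth-applyUpTo f zero    f≡0 j       = ≡.sym (f≡0 j z≤n)
nth-applyUpTo f (suc n) f≡0 zero    = refl
nth-applyUpTo f (suc n) f≡0 (suc j) =
  nth-applyUpTo (f ∘ suc) n (λ k n≤k → f≡0 (suc k) (s≤s n≤k)) j

infix 8 _ᵗ

_ᵗ : Partition → Partition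
σ ᵗ = record
  { parts      = applyUpTo (column (parts σ)) (part σ 0)
  ; decreasing = Linked-applyUpTo⁺ _ (part σ 0) (λ j → ≤-from-< (λ i i<c →
      column⁺ (decreasing σ) i j (≤-trans (s≤s (n≤1+n j)) (column⁻ (decreasing σ) i (suc j) i<c))))
  ; positive   = All-applyUpTo⁺ _ (part σ 0) (λ {j} → column⁺ (decreasing σ) 0 j)
  }

column-beyond : ∀ σ j → part σ 0 ≤ j → column (parts σ) j ≡ 0
column-beyond σ j σ₀≤j with column (parts σ) j | column⁻ (decreasing σ) 0 j
... | zero  | _ = refl
... | suc _ | f = ⊥-elim (<-irrefl refl (<-≤-trans (f (s≤s z≤n)) σ₀≤j))

part-ᵗ : ∀ σ j → part (σ ᵗ) j ≡ column (parts σ) j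
part-ᵗ σ = nth-applyUpTo _ (part σ 0) (column-beyond σ)

-- _ᵗ is the partition with the transposed Young diagram.
Y-ᵗ : ∀ σ i j → Y (σ ᵗ) j i ⇔ Y σ i j
Y-ᵗ σ i j = mk⇔
  (λ y → column⁻ (decreasing σ) i j (≡.subst (i <_) (part-ᵗ σ j) y))
  (λ y → ≡.subst (i <_) (≡.sym (part-ᵗ σ j)) (column⁺ (decreasing σ) i j y))

record SkewPartition : Set where
  field
    outer     : Partition
    inner     : Partition
    contained : ∀ i → part inner i ≤ part outer i

open SkewPartition public

infix 8 _ᵗˢ

_ᵗˢ : SkewPartition → SkewPartition
θ ᵗˢ = record
  { outer     = outer θ ᵗ
  ; inner     = inner θ ᵗ
  ; contained = λ j → ≤-from-< (λ i y →
      Equivalence.from (Y-ᵗ (outer θ) i j)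
        (<-≤-trans (Equivalence.to (Y-ᵗ (inner θ) i j) y) (contained θ i)))
  }

-- The polynomial ring ℤ[X], as the free commutative ℤ-algebra on X:
-- ring expressions modulo the congruence generated by the ring axioms
-- and the arithmetic of ℤ.

infixl 6 _:+_
infixl 7 _:*_
infix  8 :-_
infix  4 _≋_

data Poly (X : Set) : Set where
  con  : ℤ → Poly X
  var  : X → Poly X
  _:+_ : Poly X → Poly X → Poly X
  _:*_ : Poly X → Poly X → Poly X
  :-_  : Poly X → Poly X

data _≋_ {X : Set} : Poly X → Poly X → Set where
  ≋-refl  : ∀ {f} → f ≋ f
  ≋-sym   : ∀ {f g} → f ≋ g → g ≋ f
  ≋-trans : ∀ {f g k} → f ≋ g → g ≋ k → f ≋ k
  :+-cong : ∀ {f f′ g g′} → f ≋ f′ → g ≋ g′ → f :+ g ≋ f′ :+ g′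
  :*-cong : ∀ {f f′ g g′} → f ≋ f′ → g ≋ g′ → f :* g ≋ f′ :* g′
  :--cong : ∀ {f f′} → f ≋ f′ → :- f ≋ :- f′
  :+-assoc     : ∀ f g k → (f :+ g) :+ k ≋ f :+ (g :+ k)
  :+-comm      : ∀ f g → f :+ g ≋ g :+ f
  :+-identityˡ : ∀ f → con 0ℤ :+ f ≋ f
  :--inverseˡ  : ∀ f → :- f :+ f ≋ con 0ℤ
  :*-assoc     : ∀ f g k → (f :* g) :* k ≋ f :* (g :* k)
  :*-comm      : ∀ f g → f :* g ≋ g :* f
  :*-identityˡ : ∀ f → con 1ℤ :* f ≋ f
  :*-distribˡ  : ∀ f g k → f :* (g :+ k) ≋ f :* g :+ f :* k
  con-+ : ∀ m n → con (m ℤ.+ n) ≋ con m :+ con n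
  con-* : ∀ m n → con (m ℤ.* n) ≋ con m :* con n

polyRing : Set → CommutativeRing Level.zero Level.zero
polyRing X = record
  { Carrier = Poly X
  ; _≈_ = _≋_
  ; _+_ = _:+_
  ; _*_ = _:*_
  ; -_  = :-_
  ; 0#  = con 0ℤ
  ; 1#  = con 1ℤ
  ; isCommutativeRing = record
    { isRing = record
      { +-isAbelianGroup = record
        { isGroup = record
          { isMonoid = record
            { isSemigroup = record
              { isMagma = record { isEquivalence = isEquiv ; ∙-cong = :+-cong }
              ; assoc   = :+-assoc
              }
            ; identity = comm∧idˡ⇒id :+-comm :+-identityˡ
            }
          ; inverse = comm∧invˡ⇒inv :+-comm :--inverseˡ
          ; ⁻¹-cong = :--cong
          }
        ; comm = :+-comm
        }
      ; *-cong     = :*-cong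
      ; *-assoc    = :*-assoc
      ; *-identity = comm∧idˡ⇒id :*-comm :*-identityˡ
      ; distrib    = comm∧distrˡ⇒distr :+-cong :*-comm :*-distribˡ
      }
    ; *-comm = :*-comm
    }
  }
  where
  isEquiv : IsEquivalence (_≋_ {X})
  isEquiv = record { refl = ≋-refl ; sym = ≋-sym ; trans = ≋-trans }

  polySetoid : Setoid Level.zero Level.zero
  polySetoid = record { isEquivalence = isEquiv }

  open Consequences polySetoid

rename : ∀ {X Z} → (X → Z) → Poly X → Poly Z
rename ρ (con c)  = con c
rename ρ (var x)  = var (ρ x)
rename ρ (f :+ g) = rename ρ f :+ rename ρ g
rename ρ (f :* g) = rename ρ f :* rename ρ g
rename ρ (:- f)   = :- rename ρ f

-- 𝒫 = ℤ[h₁, h₂, h₃, …]; the variable with index n stands for hₙ₊₁.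
𝒫 : Set
𝒫 = Poly ℕ

-- f ∈ℤ[h₁⋯h N ] : f involves only h₁, …, h_N, that is, f lies in the
-- subring ℤ[h₁, …, h_N] of 𝒫.
_∈ℤ[h₁⋯h_] : 𝒫 → ℕ → Set
f ∈ℤ[h₁⋯h N ] = ∃ λ (g : Poly (Fin N)) → rename toℕ g ≋ f

rename-rename : ∀ {X Z W} {ρ : Z → W} {π : X → Z} {τ : X → W} →
                (∀ x → ρ (π x) ≡ τ x) → ∀ f → rename ρ (rename π f) ≡ rename τ f
rename-rename eq (con c)  = refl
rename-rename eq (var x)  = ≡.cong var (eq x)
rename-rename eq (f :+ g) = ≡.cong₂ _:+_ (rename-rename eq f) (rename-rename eq g)
rename-rename eq (f :* g) = ≡.cong₂ _:*_ (rename-rename eq f) (rename-rename eq g)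
rename-rename eq (:- f)   = ≡.cong :-_ (rename-rename eq f)

∈-weaken : ∀ {f M N} → M ≤ N → f ∈ℤ[h₁⋯h M ] → f ∈ℤ[h₁⋯h N ]
∈-weaken M≤N (g , g≋f) =
  rename (λ x → inject≤ x M≤N) g ,
  ≡.subst (_≋ _) (≡.sym (rename-rename (λ x → toℕ-inject≤ x M≤N) g)) g≋f

∈-exists : ∀ f → ∃ λ N → f ∈ℤ[h₁⋯h N ]
∈-exists (con c) = 0 , con c , ≋-refl
∈-exists (var n) = suc n , var (fromℕ n) ,
  ≡.subst (λ m → var m ≋ var n) (≡.sym (toℕ-fromℕ n)) ≋-refl
∈-exists (f :+ g) with ∈-exists f | ∈-exists g
... | M , f∈ | N , g∈ with ∈-weaken (m≤m⊔n M N) f∈ | ∈-weaken (m≤n⊔m M N) g∈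
... | f′ , f′≋f | g′ , g′≋g = M ⊔ N , f′ :+ g′ , :+-cong f′≋f g′≋g
∈-exists (f :* g) with ∈-exists f | ∈-exists g
... | M , f∈ | N , g∈ with ∈-weaken (m≤m⊔n M N) f∈ | ∈-weaken (m≤n⊔m M N) g∈
... | f′ , f′≋f | g′ , g′≋g = M ⊔ N , f′ :* g′ , :*-cong f′≋f g′≋g
∈-exists (:- f) with ∈-exists f
... | N , f′ , f′≋f = N , :- f′ , :--cong f′≋f

module _ {c l} (R : CommutativeRing c l) where
  open CommutativeRing R hiding (zero)
  open RawSemiringDefinitions (Semiring.rawSemiring semiring) using (sum; _^_)

  -- Laplace expansion along the first row
  det : ∀ {n} → (Fin n → Fin n → Carrier) → Carrier
  det {zero}  A = 1#
  det {suc n} A = sum λ j →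
    (- 1#) ^ toℕ j * (A zero j * det λ i k → A (suc i) (punchIn j k))

h : ℤ → 𝒫
h (+ zero)  = con 1ℤ
h (+ suc n) = var n
h -[1+ _ ]  = con 0ℤ

-- Indexing rows and columns from 0 leaves - i + j unchanged.
s : SkewPartition → 𝒫
s θ = det (polyRing ℕ) λ (i j : Fin (ℓ (outer θ))) →
  h (+ part (outer θ) (toℕ i) ℤ.- + part (inner θ) (toℕ j) ℤ.- + toℕ i ℤ.+ + toℕ j)

record FiniteField (q : ℕ) c l : Set (Level.suc (c Level.⊔ l)) where
  field
    commutativeRing : CommutativeRing c l

  open CommutativeRing commutativeRing public

  field
    0≉1         : ¬ (0# ≈ 1#)
    invertible  : ∀ x → ¬ (x ≈ 0#) → ∃ λ y → x * y ≈ 1#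
    enumeration : Inverse setoid (≡.setoid (Fin q))

  _≟_ : Decidable _≈_
  _≟_ = via-injection (Inverse⇒Injection enumeration) _≟ᶠ_

  elements : List Carrier
  elements = map (Inverse.from enumeration) (allFin q)

  q≢0 : NonZero q
  q≢0 = nonZeroIndex (Inverse.to enumeration 0#)

module _ {q c l} (F : FiniteField q c l) where
  open FiniteField F hiding (zero)
  open RawSemiringDefinitions (Semiring.rawSemiring semiring) using () renaming (_×_ to _·_)

  fromℤ : ℤ → Carrier
  fromℤ (+ n)    = n · 1#
  fromℤ -[1+ n ] = - (suc n · 1#)

  eval : ∀ {X} → (X → Carrier) → Poly X → Carrier
  eval z (con c)  = fromℤ c
  eval z (var x)  = z x
  eval z (f :+ g) = eval z f + eval z g
  eval z (f :* g) = eval z f * eval z g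
  eval z (:- f)   = - eval z f

  -- F^N, each point listed once up to pointwise ≈
  points : ∀ N → List (Vec Carrier N)
  points zero    = [ [] ]
  points (suc N) = cartesianProductWith _∷_ elements (points N)

  -- P f N f∈ a is P(f ↦ a), computed with the N such that f ∈ ℤ[h₁, …, h_N]
  P : ∀ f N → f ∈ℤ[h₁⋯h N ] → Carrier → ℚ
  P f N (g , _) a =
    ((+ length (filter (λ z → eval (lookup z) g ≟ a) (points N))) ℚ./ (q ℕ.^ N))
      {{m^n≢0 q N {{q≢0}}}}

-- The ring endomorphism of ℤ[h₁, h₂, …] with hₙ ↦ eₙ, where Σ eₙtⁿ is the
-- inverse of Σ hₙ(-t)ⁿ, sends s_{λᵗ/μᵗ} to s_{λ/μ}: this is Jacobi's identity
-- for complementary minors of the two mutually inverse Toeplitz matrices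
-- (hᵢ₋ⱼ) and ((-1)ⁱ⁻ʲ eᵢ₋ⱼ), the row and column sets of a skew Schur function
-- and of its conjugate being complementary. Since eₙ is ±hₙ plus a polynomial
-- in h₁, …, hₙ₋₁, the substitution permutes the points of F^N, one coordinate
-- after the other, so both functions take the value a equally often.

{-# OPTIONS --safe #-}
module Submission where

open import Algebra.Bundles using (CommutativeRing; Semiring)
import Algebra.Definitions.RawSemiring as RawSemiringDefinitions
import Algebra.Properties.Ring as RingProperties
import Algebra.Properties.Semiring.Mult.TCOptimised as SemiringMult
import Algebra.Properties.Semiring.Sum as SemiringSum
import Algebra.Solver.Ring as RingSolver
open import Algebra.Solver.Ring.AlmostCommutativeRing
  using (fromCommutativeRing; _-Raw-AlmostCommutative⟶_)
open import Data.Fin.Base using (Fin; zero; suc; toℕ; punchIn)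
open import Data.Fin.Permutation using (permutation)
open import Data.Fin.Properties using (toℕ<n)
open import Data.Integer.Base as ℤ using (ℤ; +_; -[1+_]; _⊖_; 0ℤ; 1ℤ)
import Data.Integer.Properties as ℤ
import Data.Integer.Solver as ℤSolver
open import Data.List.Base
  using (List; []; _∷_; _++_; _∷ʳ_; applyDownFrom; applyUpTo; cartesianProductWith;
         downFrom; filter; length; map; reverse; tabulate)
open import Data.List.Membership.Propositional using (_∈_)
open import Data.List.Properties
  using (applyUpTo-∷ʳ; filter-++; length-++; length-applyDownFrom; length-applyUpTo;
         length-filter; length-map; length-reverse; reverse-applyUpTo; unfold-reverse)
open import Data.List.Relation.Unary.All as All using (All; []; _∷_)
open import Data.List.Relation.Unary.All.Properties as All using (applyDownFrom⁺₁)
open import Data.List.Relation.Unary.Any using (here; there)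
open import Data.List.Relation.Unary.Linked as Linked using (Linked; []; [-]; _∷_)
import Data.List.Relation.Unary.Linked.Properties as Linked
import Data.Maybe.Base as Maybe
open import Data.Nat.Base as ℕ using (ℕ; zero; suc; _<_; _≤_; _≥_; _∸_; NonZero; z≤n; s≤s)
open import Data.Nat.Properties as ℕ
  using (_<?_; <-≤-trans; m+[n∸m]≡n; m<n⇒m<1+n; m^n≢0; m≤m+n; m≤n⇒m<n∨m≡n;
         suc-injective; ≤-antisym; ≤-refl; ≤-reflexive; ≤-trans; ≤⇒≯)
open import Data.Nat.Solver using (module +-*-Solver)
open import Data.Product.Base using (_×_; _,_; proj₁; proj₂)
import Data.Rational.Base as ℚ
import Data.Rational.Properties as ℚ
open import Data.Rational.Unnormalised.Base using (mkℚᵘ; *≡*)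
open import Data.Sum.Base using (_⊎_; inj₁; inj₂)
open import Data.Vec.Base using (Vec; []; _∷_; lookup)
open import Function.Base using (_∘_; flip)
open import Function.Bundles using (Inverse)
open import Relation.Binary.PropositionalEquality as ≡ using (_≡_)
open import Relation.Nullary.Decidable using (Dec; yes; no; dec⇒maybe)
open import Relation.Nullary.Negation using (contradiction)
open import Algebra.Properties.CommutativeMonoid.Sum ℕ.+-0-commutativeMonoid
  using (sum-cong-≗; sum-permute) renaming (sum to sumℕ)
open import Algebra.Properties.Semiring.Sum ℕ.+-*-semiring using (*-distribʳ-sum)
open import Defs

open +-*-Solver using ()
  renaming (solve to ℕsolve; _:+_ to _∔_; _:*_ to _⊛_; _:=_ to _≐_; con to ℕlit)

-- No endomorphism of the polynomial ring is ever formed. The determinants are evaluated first,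
-- their identity is proved for sequences in an arbitrary commutative ring, and the substitution is
-- a map on sequences `ℕ → F`. Representatives in different numbers `M` and `N` of variables are
-- thus read off one sequence. The delicate point of Jacobi's identity is its sign. A determinant is
-- an iterated contraction of a list of column labels, so every sign is governed by the length of a
-- list passed over. Label sets are listed decreasingly because the induction strikes out the
-- largest row. The box that makes them complementary has ℓ(λ) rows and λ₁ columns; μ is drawn in
-- the same box, so that both boundaries have equally many steps.

-- Integer multiples in a commutative ring, and a ring solver with integer coefficients.

module IntegerMultiples {c ℓ} (R : CommutativeRing c ℓ) where
  open CommutativeRing R hiding (zero)
  open SemiringMult semiring using (1+×; ×-homo-+; ×1-homo-*) renaming (_×_ to _·_)
  open RingProperties ring
  open import Relation.Binary.Reasoning.Setoid setoid

  -- The multiples are the optimised ones, for which `1 · x` is `x` by definition, so that the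
  -- solver's literal 1 is `1#` on the nose.
  ⟦_⟧ : ℤ → Carrier
  ⟦ + n ⟧      = n · 1#
  ⟦ -[1+ n ] ⟧ = - (suc n · 1#)

  +-cancel-- : ∀ x y z → (x + y) - (x + z) ≈ y - z
  +-cancel-- x y z = begin
    (x + y) + - (x + z)     ≈⟨ +-congˡ (-‿anti-homo-+ x z) ⟩
    (x + y) + (- z + - x)   ≈⟨ +-congʳ (+-comm x y) ⟩
    (y + x) + (- z + - x)   ≈⟨ +-assoc y x _ ⟩
    y + (x + (- z + - x))   ≈⟨ +-congˡ (+-congˡ (+-comm (- z) (- x))) ⟩
    y + (x + (- x + - z))   ≈⟨ +-congˡ (+-assoc x (- x) (- z)) ⟨
    y + ((x + - x) + - z)   ≈⟨ +-congˡ (+-congʳ (-‿inverseʳ x)) ⟩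
    y + (0# + - z)          ≈⟨ +-congˡ (+-identityˡ (- z)) ⟩
    y - z                   ∎

  ⟦⟧-⊖ : ∀ m n → ⟦ m ⊖ n ⟧ ≈ m · 1# - n · 1#
  ⟦⟧-⊖ m zero = sym (trans (+-congˡ -0#≈0#) (+-identityʳ _))
  ⟦⟧-⊖ zero (suc n) = sym (+-identityˡ _)
  ⟦⟧-⊖ (suc m) (suc n) = begin
    ⟦ suc m ⊖ suc n ⟧                  ≡⟨ ≡.cong ⟦_⟧ (ℤ.[1+m]⊖[1+n]≡m⊖n m n) ⟩
    ⟦ m ⊖ n ⟧                          ≈⟨ ⟦⟧-⊖ m n ⟩
    m · 1# - n · 1#                    ≈⟨ +-cancel-- 1# (m · 1#) (n · 1#) ⟨
    (1# + m · 1#) - (1# + n · 1#)      ≈⟨ +-cong (1+× m 1#) (-‿cong (1+× n 1#)) ⟨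
    suc m · 1# - suc n · 1#            ∎

  ⟦⟧-homo-+ : ∀ i j → ⟦ i ℤ.+ j ⟧ ≈ ⟦ i ⟧ + ⟦ j ⟧
  ⟦⟧-homo-+ (+ m)    (+ n)    = ×-homo-+ 1# m n
  ⟦⟧-homo-+ (+ m)    -[1+ n ] = ⟦⟧-⊖ m (suc n)
  ⟦⟧-homo-+ -[1+ m ] (+ n)    = trans (⟦⟧-⊖ n (suc m)) (+-comm _ _)
  ⟦⟧-homo-+ -[1+ m ] -[1+ n ] = begin
    - (suc (suc (m ℕ.+ n)) · 1#)       ≡⟨ ≡.cong (λ k → - (suc k · 1#)) (ℕ.+-suc m n) ⟨
    - ((suc m ℕ.+ suc n) · 1#)         ≈⟨ -‿cong (×-homo-+ 1# (suc m) (suc n)) ⟩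
    - (suc m · 1# + suc n · 1#)        ≈⟨ -‿+-comm _ _ ⟨
    - (suc m · 1#) - (suc n · 1#)      ∎

  ⟦⟧-homo-- : ∀ i → ⟦ ℤ.- i ⟧ ≈ - ⟦ i ⟧
  ⟦⟧-homo-- (+ zero)  = sym -0#≈0#
  ⟦⟧-homo-- (+ suc n) = refl
  ⟦⟧-homo-- -[1+ n ]  = sym (-‿involutive _)

  ⟦⟧-homo-+* : ∀ m j → ⟦ + m ℤ.* j ⟧ ≈ ⟦ + m ⟧ * ⟦ j ⟧
  ⟦⟧-homo-+* m (+ n) = begin
    ⟦ + m ℤ.* + n ⟧   ≡⟨ ≡.cong ⟦_⟧ (ℤ.pos-* m n) ⟨
    (m ℕ.* n) · 1#    ≈⟨ ×1-homo-* m n ⟩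
    m · 1# * n · 1#   ∎
  ⟦⟧-homo-+* m -[1+ n ] = begin
    ⟦ + m ℤ.* -[1+ n ] ⟧      ≡⟨ ≡.cong ⟦_⟧ (ℤ.neg-distribʳ-* (+ m) (+ suc n)) ⟨
    ⟦ ℤ.- (+ m ℤ.* + suc n) ⟧ ≈⟨ ⟦⟧-homo-- (+ m ℤ.* + suc n) ⟩
    - ⟦ + m ℤ.* + suc n ⟧     ≈⟨ -‿cong (⟦⟧-homo-+* m (+ suc n)) ⟩
    - (m · 1# * suc n · 1#)   ≈⟨ -‿distribʳ-* _ _ ⟩
    m · 1# * - (suc n · 1#)   ∎

  ⟦⟧-homo-* : ∀ i j → ⟦ i ℤ.* j ⟧ ≈ ⟦ i ⟧ * ⟦ j ⟧
  ⟦⟧-homo-* (+ m) j = ⟦⟧-homo-+* m j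
  ⟦⟧-homo-* -[1+ m ] j = begin
    ⟦ -[1+ m ] ℤ.* j ⟧        ≡⟨ ≡.cong ⟦_⟧ (ℤ.neg-distribˡ-* (+ suc m) j) ⟨
    ⟦ ℤ.- (+ suc m ℤ.* j) ⟧   ≈⟨ ⟦⟧-homo-- (+ suc m ℤ.* j) ⟩
    - ⟦ + suc m ℤ.* j ⟧       ≈⟨ -‿cong (⟦⟧-homo-+* (suc m) j) ⟩
    - (suc m · 1# * ⟦ j ⟧)    ≈⟨ -‿distribˡ-* _ _ ⟩
    - (suc m · 1#) * ⟦ j ⟧    ∎

  ⟦⟧-morphism : ℤ.+-*-rawRing -Raw-AlmostCommutative⟶ fromCommutativeRing R
  ⟦⟧-morphism = record
    { ⟦_⟧    = ⟦_⟧
    ; +-homo = ⟦⟧-homo-+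
    ; *-homo = ⟦⟧-homo-*
    ; -‿homo = ⟦⟧-homo--
    ; 0-homo = refl
    ; 1-homo = refl
    }

  open RingSolver ℤ.+-*-rawRing (fromCommutativeRing R) ⟦⟧-morphism
    (λ i j → Maybe.map (reflexive ∘ ≡.cong ⟦_⟧) (dec⇒maybe (i ℤ.≟ j)))
    public using (solve; _:=_)
    renaming (con to lit; _:+_ to _⊕_; _:*_ to _⊗_; _:-_ to _⊝_; :-_ to ⊟_)

-- Determinants over lists of row and column labels.

module Determinants {c ℓ} (R : CommutativeRing c ℓ) where
  open CommutativeRing R hiding (zero)
  open RawSemiringDefinitions (Semiring.rawSemiring semiring) using (_^_)
  open RingProperties ring using (-0#≈0#)
  open IntegerMultiples R using (solve; _:=_; lit; _⊕_; _⊗_; _⊝_; ⊟_)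
  open import Relation.Binary.Reasoning.Setoid setoid

  private variable
    C X : Set

  ε : ℕ → Carrier
  ε n = (- 1#) ^ n

  ε-+ : ∀ m n → ε (m ℕ.+ n) ≈ ε m * ε n
  ε-+ zero    n = sym (*-identityˡ _)
  ε-+ (suc m) n = trans (*-congˡ (ε-+ m n)) (sym (*-assoc _ _ _))

  ε-square : ∀ n → ε n * ε n ≈ 1#
  ε-square zero    = *-identityˡ _
  ε-square (suc n) = trans
    (solve 1 (λ x → ((⊟ lit 1ℤ) ⊗ x) ⊗ ((⊟ lit 1ℤ) ⊗ x) := x ⊗ x) refl (ε n))
    (ε-square n)

  -- The signed contraction of the list c₁ ∧ ⋯ ∧ cₙ by f, followed by Φ:
  -- Σⱼ (-1)ʲ⁻¹ f(cⱼ) Φ(c₁, …, ĉⱼ, …, cₙ).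
  ι : (C → Carrier) → (List C → Carrier) → List C → Carrier
  ι f Φ []       = 0#
  ι f Φ (c ∷ cs) = f c * Φ cs - ι f (λ ds → Φ (c ∷ ds)) cs

  ι-cong : ∀ {f g : C → Carrier} {Φ Ψ} cs → (∀ c → f c ≈ g c) →
           (∀ ds → suc (length ds) ≡ length cs → Φ ds ≈ Ψ ds) → ι f Φ cs ≈ ι g Ψ cs
  ι-cong []       f≈g Φ≈Ψ = refl
  ι-cong (c ∷ cs) f≈g Φ≈Ψ = +-cong (*-cong (f≈g c) (Φ≈Ψ cs ≡.refl))
    (-‿cong (ι-cong cs f≈g (λ ds eq → Φ≈Ψ (c ∷ ds) (≡.cong suc eq))))

  ι-congʳ : ∀ {f : C → Carrier} {Φ Ψ} → (∀ ds → Φ ds ≈ Ψ ds) → ∀ cs → ι f Φ cs ≈ ι f Ψ cs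
  ι-congʳ Φ≈Ψ cs = ι-cong cs (λ _ → refl) (λ ds _ → Φ≈Ψ ds)

  -- On a list `c ∷ ds` a contraction unfolds to a product minus a contraction; linearity is stated
  -- for this shape, so that nested contractions expand.
  ι-linear : ∀ (f : C → Carrier) a Φ Ψ cs →
             ι f (λ ds → a * Φ ds - Ψ ds) cs ≈ a * ι f Φ cs - ι f Ψ cs
  ι-linear f a Φ Ψ [] = solve 1 (λ a → lit 0ℤ := a ⊗ lit 0ℤ ⊝ lit 0ℤ) refl a
  ι-linear f a Φ Ψ (c ∷ cs) = trans
    (+-congˡ (-‿cong (ι-linear f a (λ ds → Φ (c ∷ ds)) (λ ds → Ψ (c ∷ ds)) cs)))
    (solve 6 (λ x a y z u v → x ⊗ (a ⊗ y ⊝ z) ⊝ (a ⊗ u ⊝ v) := a ⊗ (x ⊗ y ⊝ u) ⊝ (x ⊗ z ⊝ v))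
      refl (f c) a (Φ cs) (Ψ cs) _ _)

  ι-scaleʳ : ∀ (f : C → Carrier) a Φ cs → ι f (λ ds → a * Φ ds) cs ≈ a * ι f Φ cs
  ι-scaleʳ f a Φ []       = sym (zeroʳ a)
  ι-scaleʳ f a Φ (c ∷ cs) = trans
    (+-congˡ (-‿cong (ι-scaleʳ f a (λ ds → Φ (c ∷ ds)) cs)))
    (solve 4 (λ x a y u → x ⊗ (a ⊗ y) ⊝ a ⊗ u := a ⊗ (x ⊗ y ⊝ u)) refl (f c) a (Φ cs) _)

  ι-scaleˡ : ∀ (f : C → Carrier) a Φ cs → ι (λ c → a * f c) Φ cs ≈ a * ι f Φ cs
  ι-scaleˡ f a Φ []       = sym (zeroʳ a)
  ι-scaleˡ f a Φ (c ∷ cs) = trans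
    (+-congˡ (-‿cong (ι-scaleˡ f a (λ ds → Φ (c ∷ ds)) cs)))
    (solve 4 (λ x a y u → (a ⊗ x) ⊗ y ⊝ a ⊗ u := a ⊗ (x ⊗ y ⊝ u)) refl (f c) a (Φ cs) _)

  ι-+ˡ : ∀ (f g : C → Carrier) Φ cs → ι (λ c → f c + g c) Φ cs ≈ ι f Φ cs + ι g Φ cs
  ι-+ˡ f g Φ []       = sym (+-identityˡ 0#)
  ι-+ˡ f g Φ (c ∷ cs) = trans
    (+-congˡ (-‿cong (ι-+ˡ f g (λ ds → Φ (c ∷ ds)) cs)))
    (solve 5 (λ x y p u v → (x ⊕ y) ⊗ p ⊝ (u ⊕ v) := (x ⊗ p ⊝ u) ⊕ (y ⊗ p ⊝ v))
      refl (f c) (g c) (Φ cs) _ _)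

  ι-zeroʳ : ∀ {f : C → Carrier} {Φ} → (∀ ds → Φ ds ≈ 0#) → ∀ cs → ι f Φ cs ≈ 0#
  ι-zeroʳ {f = f} {Φ} Φ≈0 cs = trans
    (ι-congʳ (λ ds → trans (Φ≈0 ds) (sym (zeroˡ (Φ ds)))) cs)
    (trans (ι-scaleʳ f 0# Φ cs) (zeroˡ _))

  ι-zeroˡ : ∀ {f : C → Carrier} {Φ cs} → All (λ c → f c ≈ 0#) cs → ι f Φ cs ≈ 0#
  ι-zeroˡ []           = refl
  ι-zeroˡ (fc≈0 ∷ f≈0) = trans
    (+-cong (trans (*-congʳ fc≈0) (zeroˡ _)) (trans (-‿cong (ι-zeroˡ f≈0)) -0#≈0#))
    (+-identityˡ 0#)

  -- Deleting two columns in either order leaves the same list, but deleting the left one first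
  -- shifts the position of the other, which flips the sign.
  ι-anticomm : ∀ (f g : C → Carrier) Φ cs → ι f (ι g Φ) cs ≈ - ι g (ι f Φ) cs
  ι-anticomm f g Φ []       = sym -0#≈0#
  ι-anticomm f g Φ (c ∷ cs) = begin
    f c * G - ι f (λ ds → g c * Φ ds - ι g Φc ds) cs  ≈⟨ +-congˡ (-‿cong (ι-linear f (g c) Φ (ι g Φc) cs)) ⟩
    f c * G - (g c * F - ι f (ι g Φc) cs)
      ≈⟨ +-congˡ (-‿cong (+-congˡ (-‿cong (ι-anticomm f g Φc cs)))) ⟩
    f c * G - (g c * F - - H)
      ≈⟨ solve 5 (λ x u y v w → x ⊗ u ⊝ (y ⊗ v ⊝ (⊟ w)) := ⊟ (y ⊗ v ⊝ (x ⊗ u ⊝ w)))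
           refl (f c) G (g c) F H ⟩
    - (g c * F - (f c * G - H))                       ≈⟨ -‿cong (+-congˡ (-‿cong (ι-linear g (f c) Φ (ι f Φc) cs))) ⟨
    - (g c * F - ι g (λ ds → f c * Φ ds - ι f Φc ds) cs) ∎
    where
    Φc = λ ds → Φ (c ∷ ds)
    F = ι f Φ cs
    G = ι g Φ cs
    H = ι g (ι f Φc) cs

  -- Anticommutativity would only give x = -x, which says nothing in characteristic 2; here the two
  -- equal products cancel instead.
  ι-square : ∀ (f : C → Carrier) Φ cs → ι f (ι f Φ) cs ≈ 0#
  ι-square f Φ []       = refl
  ι-square f Φ (c ∷ cs) = begin
    f c * F - ι f (λ ds → f c * Φ ds - ι f Φc ds) cs  ≈⟨ +-congˡ (-‿cong (ι-linear f (f c) Φ (ι f Φc) cs)) ⟩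
    f c * F - (f c * F - ι f (ι f Φc) cs)
      ≈⟨ solve 2 (λ x y → x ⊝ (x ⊝ y) := y) refl (f c * F) (ι f (ι f Φc) cs) ⟩
    ι f (ι f Φc) cs                                   ≈⟨ ι-square f Φc cs ⟩
    0#                                                ∎
    where
    Φc = λ ds → Φ (c ∷ ds)
    F = ι f Φ cs

  -- The Leibniz rule for contracting a wedge product: to reach the second factor, the contraction
  -- passes the first.
  ι-++ : ∀ (f : C → Carrier) Φ bs cs →
         ι f Φ (bs ++ cs) ≈ ι f (λ ds → Φ (ds ++ cs)) bs + ε (length bs) * ι f (λ ds → Φ (bs ++ ds)) cs
  ι-++ f Φ []       cs = solve 1 (λ x → x := lit 0ℤ ⊕ lit 1ℤ ⊗ x) refl _
  ι-++ f Φ (b ∷ bs) cs = trans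
    (+-congˡ (-‿cong (ι-++ f (λ ds → Φ (b ∷ ds)) bs cs)))
    (solve 4 (λ x u e v → x ⊝ (u ⊕ e ⊗ v) := (x ⊝ u) ⊕ ((⊟ lit 1ℤ) ⊗ e) ⊗ v)
      refl (f b * Φ (bs ++ cs)) _ (ε (length bs)) _)

  -- The determinant of the matrix (β x c) with rows x and columns c.
  D : (X → C → Carrier) → List X → List C → Carrier
  D β []       []      = 1#
  D β []       (_ ∷ _) = 0#
  D β (x ∷ xs) cs      = ι (β x) (D β xs) cs

  D-cong : ∀ {β γ : X → C → Carrier} → (∀ x c → β x c ≈ γ x c) → ∀ xs cs → D β xs cs ≈ D γ xs cs
  D-cong β≈γ []       []      = refl
  D-cong β≈γ []       (_ ∷ _) = refl
  D-cong β≈γ (x ∷ xs) cs      = ι-cong cs (β≈γ x) (λ ds _ → D-cong β≈γ xs ds)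

  ι-map : ∀ {C′} (κ : C → C′) (f : C′ → Carrier) Φ cs → ι f Φ (map κ cs) ≈ ι (f ∘ κ) (Φ ∘ map κ) cs
  ι-map κ f Φ []       = refl
  ι-map κ f Φ (c ∷ cs) = +-congˡ (-‿cong (ι-map κ f (λ ds → Φ (κ c ∷ ds)) cs))

  D-map : ∀ {C′} (β : X → C′ → Carrier) (κ : C → C′) xs cs →
          D β xs (map κ cs) ≈ D (λ x → β x ∘ κ) xs cs
  D-map β κ []       []      = refl
  D-map β κ []       (_ ∷ _) = refl
  D-map β κ (x ∷ xs) cs      = trans (ι-map κ (β x) (D β xs) cs) (ι-congʳ (D-map β κ xs) cs)

  D-zeroColumn : ∀ (β : X → C → Carrier) {xs c} → All (λ x → β x c ≈ 0#) xs →
                 ∀ bs cs → D β xs (bs ++ c ∷ cs) ≈ 0#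
  D-zeroColumn β []       []       cs = refl
  D-zeroColumn β []       (_ ∷ _)  cs = refl
  D-zeroColumn β {x ∷ xs} {c} (βxc≈0 ∷ β≈0) bs cs = begin
    ι (β x) Φ (bs ++ c ∷ cs)
      ≈⟨ ι-++ (β x) Φ bs (c ∷ cs) ⟩
    ι (β x) (λ ds → Φ (ds ++ c ∷ cs)) bs
      + ε (length bs) * (β x c * Φ (bs ++ cs) - ι (β x) (λ ds → Φ (bs ++ c ∷ ds)) cs)
      ≈⟨ +-cong (ι-zeroʳ (λ ds → D-zeroColumn β β≈0 ds cs) bs)
           (*-congˡ (+-cong (*-congʳ βxc≈0) (-‿cong (ι-zeroʳ (D-zeroColumn β β≈0 bs) cs)))) ⟩
    0# + ε (length bs) * (0# * Φ (bs ++ cs) - 0#)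
      ≈⟨ solve 2 (λ e p → lit 0ℤ ⊕ e ⊗ (lit 0ℤ ⊗ p ⊝ lit 0ℤ) := lit 0ℤ) refl (ε (length bs)) (Φ (bs ++ cs)) ⟩
    0# ∎
    where Φ = D β xs

  -- `ι-anticomm` carries the row past its successors until it meets its copy, where `ι-square`
  -- applies.
  D-repeatedRow : ∀ (β : X → C → Carrier) {x xs} → x ∈ xs → ∀ cs → D β (x ∷ xs) cs ≈ 0#
  D-repeatedRow β {x} {_ ∷ xs} (here ≡.refl) cs = ι-square (β x) (D β xs) cs
  D-repeatedRow β {x} {y ∷ xs} (there x∈) cs = trans (ι-anticomm (β x) (β y) (D β xs) cs)
    (trans (-‿cong (ι-zeroʳ (D-repeatedRow β {x} {xs} x∈) cs)) -0#≈0#)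

  -- `a 0` belongs to the head of the list, so along `downFrom n` a coefficient depends only on the
  -- distance from row `n`, as in a Toeplitz matrix.
  combination : (X → C → Carrier) → (ℕ → Carrier) → List X → C → Carrier
  combination β a []       c = 0#
  combination β a (x ∷ xs) c = a 0 * β x c + combination β (a ∘ suc) xs c

  ι-combination : ∀ (β : X → C → Carrier) a {xs ys} → All (_∈ ys) xs →
                  ∀ cs → ι (combination β a xs) (D β ys) cs ≈ 0#
  ι-combination β a []                 cs = ι-zeroˡ (All.universal (λ _ → refl) cs)
  ι-combination β a {x ∷ xs} {ys} (x∈ ∷ xs⊆) cs = begin
    ι (λ c → a 0 * β x c + combination β (a ∘ suc) xs c) (D β ys) cs
      ≈⟨ ι-+ˡ _ (combination β (a ∘ suc) xs) (D β ys) cs ⟩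
    ι (λ c → a 0 * β x c) (D β ys) cs + ι (combination β (a ∘ suc) xs) (D β ys) cs
      ≈⟨ +-cong (ι-scaleˡ (β x) (a 0) (D β ys) cs) (ι-combination β (a ∘ suc) xs⊆ cs) ⟩
    a 0 * D β (x ∷ ys) cs + 0#
      ≈⟨ +-congʳ (*-congˡ (D-repeatedRow β x∈ cs)) ⟩
    a 0 * 0# + 0#
      ≈⟨ solve 1 (λ a → a ⊗ lit 0ℤ ⊕ lit 0ℤ := lit 0ℤ) refl (a 0) ⟩
    0# ∎

  D-rowOperation : ∀ (β : X → C → Carrier) (f : C → Carrier) a x xs →
                   (∀ c → f c ≈ β x c + combination β a xs c) →
                   ∀ cs → ι f (D β xs) cs ≈ D β (x ∷ xs) cs
  D-rowOperation β f a x xs f≈ cs = begin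
    ι f (D β xs) cs                                              ≈⟨ ι-cong cs f≈ (λ _ _ → refl) ⟩
    ι (λ c → β x c + combination β a xs c) (D β xs) cs           ≈⟨ ι-+ˡ (β x) (combination β a xs) (D β xs) cs ⟩
    D β (x ∷ xs) cs + ι (combination β a xs) (D β xs) cs         ≈⟨ +-congˡ (ι-combination β a {xs} {xs} (All.tabulate (λ y∈ → y∈)) cs) ⟩
    D β (x ∷ xs) cs + 0#                                         ≈⟨ +-identityʳ _ ⟩
    D β (x ∷ xs) cs                                              ∎

  ι-comm : ∀ (f : C → Carrier) (g : X → Carrier) (Φ : List X → List C → Carrier) xs cs →
           ι f (λ ds → ι g (λ ys → Φ ys ds) xs) cs ≈ ι g (λ ys → ι f (Φ ys) cs) xs
  ι-comm f g Φ []       cs = ι-zeroʳ (λ _ → refl) cs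
  ι-comm f g Φ (x ∷ xs) cs = trans
    (ι-linear f (g x) (Φ xs) (λ ds → ι g (λ ys → Φ (x ∷ ys) ds) xs) cs)
    (+-congˡ (-‿cong (ι-comm f g (λ ys → Φ (x ∷ ys)) xs cs)))

  -- Expansions along the first row and the first column share the corner term; in the rest, the two
  -- contractions act on different lists and commute without a sign.
  D-firstColumn : ∀ (β : X → C → Carrier) xs c cs →
                  D β xs (c ∷ cs) ≈ ι (flip β c) (λ ys → D β ys cs) xs
  D-firstColumn β []       c cs = refl
  D-firstColumn β (x ∷ xs) c cs = +-congˡ (-‿cong (trans
    (ι-congʳ (D-firstColumn β xs c) cs)
    (ι-comm (β x) (flip β c) (D β) xs cs)))

  D-transpose : ∀ (β : X → C → Carrier) xs cs → D β xs cs ≈ D (flip β) cs xs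
  D-transpose β []       []       = refl
  D-transpose β (_ ∷ _)  []       = refl
  D-transpose β xs       (c ∷ cs) = trans (D-firstColumn β xs c cs)
    (ι-congʳ (λ ys → D-transpose β ys cs) xs)

  D-∷ʳ : ∀ (β : X → C → Carrier) xs x cs → D β (xs ++ x ∷ []) cs ≈ ε (length xs) * D β (x ∷ xs) cs
  D-∷ʳ β []       x cs = sym (*-identityˡ _)
  D-∷ʳ β (y ∷ xs) x cs = begin
    ι (β y) (D β (xs ++ x ∷ [])) cs                   ≈⟨ ι-congʳ (D-∷ʳ β xs x) cs ⟩
    ι (β y) (λ ds → ε (length xs) * D β (x ∷ xs) ds) cs ≈⟨ ι-scaleʳ (β y) (ε (length xs)) (D β (x ∷ xs)) cs ⟩
    ε (length xs) * ι (β y) (ι (β x) (D β xs)) cs     ≈⟨ *-congˡ (ι-anticomm (β y) (β x) (D β xs) cs) ⟩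
    ε (length xs) * - D β (x ∷ y ∷ xs) cs
      ≈⟨ solve 2 (λ e d → e ⊗ (⊟ d) := ((⊟ lit 1ℤ) ⊗ e) ⊗ d) refl (ε (length xs)) (D β (x ∷ y ∷ xs) cs) ⟩
    ε (suc (length xs)) * D β (x ∷ y ∷ xs) cs         ∎

  -- The sign (-1)^(n(n-1)/2) of the permutation that reverses n letters.
  reversalSign : ℕ → Carrier
  reversalSign zero    = 1#
  reversalSign (suc n) = ε n * reversalSign n

  reversalSign-square : ∀ n → reversalSign n * reversalSign n ≈ 1#
  reversalSign-square zero    = *-identityˡ 1#
  reversalSign-square (suc n) = trans
    (solve 2 (λ e r → (e ⊗ r) ⊗ (e ⊗ r) := (e ⊗ e) ⊗ (r ⊗ r)) refl (ε n) (reversalSign n))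
    (trans (*-cong (ε-square n) (reversalSign-square n)) (*-identityˡ 1#))

  D-reverseRows : ∀ (β : X → C → Carrier) xs cs →
                  D β (reverse xs) cs ≈ reversalSign (length xs) * D β xs cs
  D-reverseRows β []       cs = sym (*-identityˡ _)
  D-reverseRows β (x ∷ xs) cs = begin
    D β (reverse (x ∷ xs)) cs                   ≡⟨ ≡.cong (λ ys → D β ys cs) (unfold-reverse x xs) ⟩
    D β (reverse xs ++ x ∷ []) cs               ≈⟨ D-∷ʳ β (reverse xs) x cs ⟩
    ε (length (reverse xs)) * ι (β x) (D β (reverse xs)) cs
      ≡⟨ ≡.cong (λ n → ε n * ι (β x) (D β (reverse xs)) cs) (length-reverse xs) ⟩
    ε n * ι (β x) (D β (reverse xs)) cs         ≈⟨ *-congˡ (ι-congʳ (D-reverseRows β xs) cs) ⟩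
    ε n * ι (β x) (λ ds → reversalSign n * D β xs ds) cs
      ≈⟨ *-congˡ (ι-scaleʳ (β x) (reversalSign n) (D β xs) cs) ⟩
    ε n * (reversalSign n * D β (x ∷ xs) cs)    ≈⟨ *-assoc _ _ _ ⟨
    (ε n * reversalSign n) * D β (x ∷ xs) cs    ∎
    where n = length xs

  D-reverse : ∀ (β : X → C → Carrier) xs cs → length xs ≡ length cs →
              D β (reverse xs) (reverse cs) ≈ D β xs cs
  D-reverse β xs cs eq = begin
    D β (reverse xs) (reverse cs)             ≈⟨ D-reverseRows β xs (reverse cs) ⟩
    r * D β xs (reverse cs)                   ≈⟨ *-congˡ (D-transpose β xs (reverse cs)) ⟩
    r * D (flip β) (reverse cs) xs            ≈⟨ *-congˡ (D-reverseRows (flip β) cs xs) ⟩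
    r * (reversalSign (length cs) * D (flip β) cs xs)
      ≡⟨ ≡.cong (λ n → r * (reversalSign n * D (flip β) cs xs)) eq ⟨
    r * (r * D (flip β) cs xs)                ≈⟨ *-assoc _ _ _ ⟨
    (r * r) * D (flip β) cs xs
      ≈⟨ *-cong (reversalSign-square (length xs)) (sym (D-transpose β xs cs)) ⟩
    1# * D β xs cs                            ≈⟨ *-identityˡ _ ⟩
    D β xs cs                                 ∎
    where r = reversalSign (length xs)

  open SemiringSum semiring using (sum; sum-cong-≋; *-distribˡ-sum)

  ι-tabulate : ∀ (f : C → Carrier) Φ {n} (κ : Fin (suc n) → C) →
               ι f Φ (tabulate κ) ≈ sum (λ j → ε (toℕ j) * (f (κ j) * Φ (tabulate (κ ∘ punchIn j))))
  ι-tabulate f Φ {zero} κ = solve 1 (λ x → x ⊝ lit 0ℤ := lit 1ℤ ⊗ x ⊕ lit 0ℤ) refl (f (κ zero) * Φ [])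
  ι-tabulate f Φ {suc n} κ = begin
    t - ι f (λ ds → Φ (κ zero ∷ ds)) (tabulate (κ ∘ suc))
      ≈⟨ +-congˡ (-‿cong (ι-tabulate f (λ ds → Φ (κ zero ∷ ds)) (κ ∘ suc))) ⟩
    t - sum S
      ≈⟨ solve 2 (λ t s → t ⊝ s := lit 1ℤ ⊗ t ⊕ (⊟ lit 1ℤ) ⊗ s) refl t (sum S) ⟩
    1# * t + - 1# * sum S
      ≈⟨ +-congˡ (trans (*-distribˡ-sum (- 1#) S) (sum-cong-≋ {suc n} (λ j → sym (*-assoc (- 1#) (ε (toℕ j)) (T j))))) ⟩
    1# * t + sum (λ j → ε (suc (toℕ j)) * (f (κ (suc j)) * Φ (κ zero ∷ tabulate (κ ∘ suc ∘ punchIn j)))) ∎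
    where
    t = f (κ zero) * Φ (tabulate (κ ∘ suc))
    T S : Fin (suc n) → Carrier
    T j = f (κ (suc j)) * Φ (κ zero ∷ tabulate (κ ∘ suc ∘ punchIn j))
    S j = ε (toℕ j) * T j

  det-D : ∀ (β : X → C → Carrier) {n} (A : Fin n → Fin n → Carrier) (ρ : Fin n → X) (κ : Fin n → C) →
          (∀ i j → A i j ≈ β (ρ i) (κ j)) → det R A ≈ D β (tabulate ρ) (tabulate κ)
  det-D β {zero}  A ρ κ A≈ = refl
  det-D β {suc n} A ρ κ A≈ = trans
    (sum-cong-≋ {suc n} (λ j → *-congˡ {ε (toℕ j)} (*-cong (A≈ zero j)
      (det-D β (λ i k → A (suc i) (punchIn j k)) (ρ ∘ suc) (κ ∘ punchIn j) (λ i k → A≈ (suc i) (punchIn j k))))))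
    (sym (ι-tabulate (β (ρ zero)) (D β (tabulate (ρ ∘ suc))) κ))

-- Jacobi's identity for complementary minors of inverse Toeplitz matrices.

-- I and J are complementary subsets of {0, …, n-1}, each listed decreasingly.
data Complementary : ℕ → List ℕ → List ℕ → Set where
  []   : Complementary 0 [] []
  inˡ  : ∀ {n I J} → Complementary n I J → Complementary (suc n) (n ∷ I) J
  inʳ  : ∀ {n I J} → Complementary n I J → Complementary (suc n) I (n ∷ J)

complementary-< : ∀ {n I J} → Complementary n I J → All (_< n) I × All (_< n) J
complementary-< []      = [] , []
complementary-< (inˡ c) with complementary-< c
... | I< , J< = ≤-refl ∷ All.map m<n⇒m<1+n I< , All.map m<n⇒m<1+n J<
complementary-< (inʳ c) with complementary-< c
... | I< , J< = All.map m<n⇒m<1+n I< , ≤-refl ∷ All.map m<n⇒m<1+n J<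

complementary-length : ∀ {n I J} → Complementary n I J → n ≡ length I ℕ.+ length J
complementary-length []              = ≡.refl
complementary-length (inˡ c)         = ≡.cong suc (complementary-length c)
complementary-length (inʳ {I = I} c) = ≡.trans (≡.cong suc (complementary-length c)) (≡.sym (ℕ.+-suc (length I) _))

downFrom-< : ∀ n → All (_< n) (downFrom n)
downFrom-< n = applyDownFrom⁺₁ _ n (λ i<n → i<n)

_◂_ : ∀ {a} {A : Set a} → A → (ℕ → A) → ℕ → A
(x ◂ z) zero    = x
(x ◂ z) (suc n) = z n

module Toeplitz {c ℓ} (R : CommutativeRing c ℓ) where
  open CommutativeRing R hiding (zero)
  open IntegerMultiples R using (solve; _:=_; lit; _⊕_; _⊗_; _⊝_; ⊟_)
  open Determinants R
  open import Relation.Binary.Reasoning.Setoid setoid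

  -- toeplitz a i j = aᵢ₋ⱼ, where aₘ = 0 for m < 0.
  toeplitz : (ℕ → Carrier) → ℕ → ℕ → Carrier
  toeplitz a i       zero    = a i
  toeplitz a zero    (suc j) = 0#
  toeplitz a (suc i) (suc j) = toeplitz a i j

  toeplitz-upper : ∀ a {i j} → i < j → toeplitz a i j ≡ 0#
  toeplitz-upper a {zero}  {suc j} (s≤s i<j) = ≡.refl
  toeplitz-upper a {suc i} {suc j} (s≤s i<j) = toeplitz-upper a i<j

  toeplitz-diagonal : ∀ a i → toeplitz a i i ≡ a 0
  toeplitz-diagonal a zero    = ≡.refl
  toeplitz-diagonal a (suc i) = toeplitz-diagonal a i

  -- On and below the diagonal the three signs multiply to (-1)^(i + j + (i - j)) = 1.
  toeplitz-ε : ∀ a i j → ε i * (ε j * toeplitz (λ n → ε n * a n) i j) ≈ toeplitz a i j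
  toeplitz-ε a i zero = trans
    (solve 2 (λ e x → e ⊗ (lit 1ℤ ⊗ (e ⊗ x)) := (e ⊗ e) ⊗ x) refl (ε i) (a i))
    (trans (*-congʳ (ε-square i)) (*-identityˡ (a i)))
  toeplitz-ε a zero (suc j) = solve 1 (λ e → lit 1ℤ ⊗ (e ⊗ lit 0ℤ) := lit 0ℤ) refl (ε (suc j))
  toeplitz-ε a (suc i) (suc j) = trans
    (solve 3 (λ d e t → ((⊟ lit 1ℤ) ⊗ d) ⊗ (((⊟ lit 1ℤ) ⊗ e) ⊗ t) := d ⊗ (e ⊗ t)) refl (ε i) (ε j) _)
    (toeplitz-ε a i j)

  -- A sequence holds the coefficient of t^(n+1) at index n, as the variable n stands for hₙ₊₁;
  -- `monic` restores the constant term.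
  monic : (ℕ → Carrier) → ℕ → Carrier
  monic z = 1# ◂ z

  δ : ℕ → Carrier
  δ = monic (λ _ → 0#)

  toeplitz-δ : ∀ {i j} → j < i → toeplitz δ i j ≡ 0#
  toeplitz-δ {suc i} {zero}  _         = ≡.refl
  toeplitz-δ {suc i} {suc j} (s≤s j<i) = toeplitz-δ j<i

  -- conv z a n = z₀aₙ₋₁ + z₁aₙ₋₂ + ⋯ + zₙ₋₁a₀.
  conv : (ℕ → Carrier) → (ℕ → Carrier) → ℕ → Carrier
  conv z a zero    = 0#
  conv z a (suc n) = z 0 * a n + conv (z ∘ suc) a n

  conv-scale : ∀ z k a n → conv z (λ i → k * a i) n ≈ k * conv z a n
  conv-scale z k a zero    = sym (zeroʳ k)
  conv-scale z k a (suc n) = trans (+-congˡ (conv-scale (z ∘ suc) k a n))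
    (solve 4 (λ z k a c → z ⊗ (k ⊗ a) ⊕ k ⊗ c := k ⊗ (z ⊗ a ⊕ c)) refl (z 0) k (a n) _)

  conv-δ : ∀ z n → conv z δ (suc n) ≈ z n
  conv-δ z zero    = trans (+-identityʳ _) (*-identityʳ (z 0))
  conv-δ z (suc n) = trans (+-cong (zeroʳ (z 0)) (conv-δ (z ∘ suc) n)) (+-identityˡ _)

  conv-shift : ∀ z a n → a 0 ≈ 0# → conv z a (suc n) ≈ conv z (a ∘ suc) n
  conv-shift z a zero    a₀≈0 = trans (+-identityʳ _) (trans (*-congˡ a₀≈0) (zeroʳ (z 0)))
  conv-shift z a (suc n) a₀≈0 = +-congˡ (conv-shift (z ∘ suc) a n a₀≈0)

  -- The hypothesis makes `b` the product of the power series `monic z` and `a`; the conclusion is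
  -- the matching product of Toeplitz matrices. Off column 0, `conv-shift` drops the summand of row
  -- 0, which lies above the diagonal.
  conv-toeplitz : ∀ z {a b} → (∀ i → b i ≈ a i + conv z a i) →
                  ∀ i j → toeplitz b i j ≈ toeplitz a i j + conv z (λ k → toeplitz a k j) i
  conv-toeplitz z b≈ i       zero    = b≈ i
  conv-toeplitz z b≈ zero    (suc j) = sym (+-identityˡ 0#)
  conv-toeplitz z b≈ (suc i) (suc j) =
    trans (conv-toeplitz z b≈ i j) (+-congˡ (sym (conv-shift z _ i refl)))

  combination-downFrom : ∀ {C : Set} (β : ℕ → C → Carrier) z n c →
                         combination β z (downFrom n) c ≡ conv z (λ k → β k c) n
  combination-downFrom β z zero    c = ≡.refl
  combination-downFrom β z (suc n) c = ≡.cong (λ x → z 0 * β n c + x) (combination-downFrom β (z ∘ suc) n c)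

  -- With H(t) = 1 + z₀t + z₁t² + ⋯ and E(t) = 1/H(-t), the unitriangular
  -- matrices (hᵢ₋ⱼ) and ((-1)ⁱ⁻ʲ eᵢ₋ⱼ) are inverse to each other. Multiplying
  -- the rows `before` by (hᵢ₋ⱼ) gives the rows `after`, with the same
  -- determinant; the columns inj₁ j are unit vectors before and the columns
  -- inj₂ j are unit vectors up to sign after. Expanding along the unit vectors
  -- yields Jacobi's identity between complementary minors.
  module _ (z e : ℕ → Carrier) (inverse : ∀ n → δ n ≈ ε n * e n + conv z (λ i → ε i * e i) n) where

    signed : ℕ → Carrier
    signed n = ε n * e n

    -- In blocks, `before` is (1 | A) and `after` is (H | HA), where A is the inverse of H with
    -- column j multiplied by (-1)^j. This factor and the row factor in `scaled` remove the signs of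
    -- the inverse by `toeplitz-ε`.
    before after scaled : ℕ → ℕ ⊎ ℕ → Carrier
    before i (inj₁ j) = toeplitz δ i j
    before i (inj₂ j) = ε j * toeplitz signed i j
    after  i (inj₁ j) = toeplitz (monic z) i j
    after  i (inj₂ j) = ε j * toeplitz δ i j
    scaled i k        = ε i * before i k

    δ-conv : ∀ n → monic z n ≈ δ n + conv z δ n
    δ-conv zero    = sym (+-identityʳ 1#)
    δ-conv (suc n) = trans (sym (conv-δ z n)) (sym (+-identityˡ _))

    after-combination : ∀ i k → after i k ≈ before i k + combination before z (downFrom i) k
    after-combination i (inj₁ j) = trans (conv-toeplitz z δ-conv i j)
      (+-congˡ (reflexive (≡.sym (combination-downFrom before z i (inj₁ j)))))
    after-combination i (inj₂ j) = begin
      ε j * toeplitz δ i j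
        ≈⟨ *-congˡ (conv-toeplitz z inverse i j) ⟩
      ε j * (toeplitz signed i j + conv z (λ k → toeplitz signed k j) i)
        ≈⟨ distribˡ _ _ _ ⟩
      ε j * toeplitz signed i j + ε j * conv z (λ k → toeplitz signed k j) i
        ≈⟨ +-congˡ (conv-scale z (ε j) (λ k → toeplitz signed k j) i) ⟨
      ε j * toeplitz signed i j + conv z (λ k → ε j * toeplitz signed k j) i
        ≡⟨ ≡.cong (λ x → ε j * toeplitz signed i j + x) (combination-downFrom before z i (inj₂ j)) ⟨
      before i (inj₂ j) + combination before z (downFrom i) (inj₂ j) ∎

    -- Row `n` changes by multiples of rows of smaller index only. These are turned back into rows
    -- of `before` first, so that a single row operation remains.
    D-after-before : ∀ n ks → D after (downFrom n) ks ≈ D before (downFrom n) ks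
    D-after-before zero    []      = refl
    D-after-before zero    (_ ∷ _) = refl
    D-after-before (suc n) ks      = trans
      (ι-congʳ (D-after-before n) ks)
      (D-rowOperation before (after n) z n (downFrom n) (after-combination n) ks)

    before-zero : ∀ {i j} → j < i → before i (inj₁ j) ≈ 0#
    before-zero j<i = reflexive (toeplitz-δ j<i)

    after-zero : ∀ {i j} → j < i → after i (inj₂ j) ≈ 0#
    after-zero j<i = trans (*-congˡ (reflexive (toeplitz-δ j<i))) (zeroʳ _)

    -- Induction on the largest row n. If n is in J, the leading column is the unit vector of that
    -- row, and both are struck out. If n is in J′, the row vanishes on the columns of J, and the
    -- contraction passes them all to reach `ks`.
    D-before : ∀ {n J J′} → Complementary n J J′ → ∀ ks →
               D before (downFrom n) (map inj₁ J ++ ks) ≈ reversalSign (length J′) * D scaled J′ ks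
    D-before []                   []      = sym (*-identityˡ 1#)
    D-before []                   (_ ∷ _) = sym (*-identityˡ 0#)
    D-before (inˡ {n} {J} {J′} c) ks      = begin
      before n (inj₁ n) * Φ (map inj₁ J ++ ks) - ι (before n) (λ ds → Φ (inj₁ n ∷ ds)) (map inj₁ J ++ ks)
        ≈⟨ +-cong (*-cong (reflexive (toeplitz-diagonal δ n)) (D-before c ks))
             (-‿cong (ι-zeroʳ (D-zeroColumn before column≈0 []) (map inj₁ J ++ ks))) ⟩
      1# * r - 0#
        ≈⟨ solve 1 (λ r → lit 1ℤ ⊗ r ⊝ lit 0ℤ := r) refl r ⟩
      r ∎
      where
      Φ = D before (downFrom n)
      r = reversalSign (length J′) * D scaled J′ ks
      column≈0 : All (λ i → before i (inj₁ n) ≈ 0#) (downFrom n)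
      column≈0 = All.map (λ i<n → reflexive (toeplitz-upper δ i<n)) (downFrom-< n)
    D-before (inʳ {n} {J} {J′} c) ks = begin
      ι (before n) Φ (map inj₁ J ++ ks)
        ≈⟨ ι-++ (before n) Φ (map inj₁ J) ks ⟩
      ι (before n) (λ ds → Φ (ds ++ ks)) (map inj₁ J)
        + ε (length (map inj₁ J)) * ι (before n) (λ ds → Φ (map inj₁ J ++ ds)) ks
        ≈⟨ +-cong (ι-zeroˡ (All.map⁺ (All.map before-zero (proj₁ (complementary-< c)))))
             (*-cong (reflexive (≡.cong ε (length-map inj₁ J)))
               (trans (ι-congʳ (D-before c) ks) (ι-scaleʳ (before n) r (D scaled J′) ks))) ⟩
      0# + ε p * (r * d)
        ≈⟨ solve 3 (λ e r d → lit 0ℤ ⊕ e ⊗ (r ⊗ d) := lit 1ℤ ⊗ ((e ⊗ r) ⊗ d)) refl (ε p) r d ⟩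
      1# * ((ε p * r) * d)
        -- Since n = p + q, one inserted `ε q` turns `ε p` into `ε n`, the factor of row n in
        -- `scaled`; the other extends the reversal sign.
        ≈⟨ *-congʳ (ε-square q) ⟨
      (ε q * ε q) * ((ε p * r) * d)
        ≈⟨ solve 4 (λ f e r d → (f ⊗ f) ⊗ ((e ⊗ r) ⊗ d) := (f ⊗ r) ⊗ ((e ⊗ f) ⊗ d)) refl (ε q) (ε p) r d ⟩
      (ε q * r) * ((ε p * ε q) * d)
        ≈⟨ *-congˡ (*-congʳ (ε-+ p q)) ⟨
      (ε q * r) * (ε (p ℕ.+ q) * d)
        ≡⟨ ≡.cong (λ n → (ε q * r) * (ε n * d)) (complementary-length c) ⟨
      (ε q * r) * (ε n * d)
        ≈⟨ *-congˡ (ι-scaleˡ (before n) (ε n) (D scaled J′) ks) ⟨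
      (ε q * r) * D scaled (n ∷ J′) ks ∎
      where
      Φ = D before (downFrom n)
      p = length J
      q = length J′
      r = reversalSign q
      d = ι (before n) (D scaled J′) ks

    -- Here the unit columns come last, so `length ks` enters the sign when a contraction passes
    -- `ks`. With the entry `ε n` of the unit column this gives `ε p * ε (p + q)`, which is `ε q`,
    -- the next factor of the reversal sign.
    D-after : ∀ {n I I′} → Complementary n I I′ → ∀ ks → length ks ≡ length I →
              D after (downFrom n) (ks ++ map inj₂ I′) ≈ reversalSign (length I′) * D after I ks
    D-after []                   []      eq = sym (*-identityˡ 1#)
    D-after (inˡ {n} {I} {I′} c) ks      eq = begin
      ι (after n) Φ (ks ++ map inj₂ I′)
        ≈⟨ ι-++ (after n) Φ ks (map inj₂ I′) ⟩
      ι (after n) (λ ds → Φ (ds ++ map inj₂ I′)) ks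
        + ε (length ks) * ι (after n) (λ ds → Φ (ks ++ ds)) (map inj₂ I′)
        ≈⟨ +-cong
             (ι-cong ks (λ _ → refl) (λ ds eq′ → D-after c ds (suc-injective (≡.trans eq′ eq))))
             (*-congˡ (ι-zeroˡ (All.map⁺ (All.map after-zero (proj₂ (complementary-< c)))))) ⟩
      ι (after n) (λ ds → r * D after I ds) ks + ε (length ks) * 0#
        ≈⟨ +-cong (ι-scaleʳ (after n) r (D after I) ks) (zeroʳ _) ⟩
      r * D after (n ∷ I) ks + 0#
        ≈⟨ +-identityʳ _ ⟩
      r * D after (n ∷ I) ks ∎
      where
      Φ = D after (downFrom n)
      r = reversalSign (length I′)
    D-after (inʳ {n} {I} {I′} c) ks eq = begin
      ι (after n) Φ (ks ++ inj₂ n ∷ map inj₂ I′)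
        ≈⟨ ι-++ (after n) Φ ks (inj₂ n ∷ map inj₂ I′) ⟩
      ι (after n) (λ ds → Φ (ds ++ inj₂ n ∷ map inj₂ I′)) ks
        + ε (length ks) * (after n (inj₂ n) * Φ (ks ++ map inj₂ I′)
                            - ι (after n) (λ ds → Φ (ks ++ inj₂ n ∷ ds)) (map inj₂ I′))
        ≈⟨ +-cong (ι-zeroʳ (λ ds → D-zeroColumn after column≈0 ds (map inj₂ I′)) ks)
             (*-cong (reflexive (≡.cong ε eq))
               (+-cong (*-cong (*-congˡ (reflexive (toeplitz-diagonal δ n))) (D-after c ks eq))
                 (-‿cong (ι-zeroʳ (D-zeroColumn after column≈0 ks) (map inj₂ I′))))) ⟩
      0# + ε p * ((ε n * 1#) * (r * d) - 0#)
        ≡⟨ ≡.cong (λ n → 0# + ε p * ((ε n * 1#) * (r * d) - 0#)) (complementary-length c) ⟩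
      0# + ε p * ((ε (p ℕ.+ q) * 1#) * (r * d) - 0#)
        ≈⟨ +-congˡ (*-congˡ (+-congʳ (*-congʳ (*-congʳ (ε-+ p q))))) ⟩
      0# + ε p * (((ε p * ε q) * 1#) * (r * d) - 0#)
        ≈⟨ solve 4 (λ e f r d → lit 0ℤ ⊕ e ⊗ (((e ⊗ f) ⊗ lit 1ℤ) ⊗ (r ⊗ d) ⊝ lit 0ℤ) := (e ⊗ e) ⊗ ((f ⊗ r) ⊗ d))
             refl (ε p) (ε q) r d ⟩
      (ε p * ε p) * ((ε q * r) * d)
        ≈⟨ *-congʳ (ε-square p) ⟩
      1# * ((ε q * r) * d)
        ≈⟨ *-identityˡ _ ⟩
      (ε q * r) * d ∎
      where
      Φ = D after (downFrom n)
      p = length I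
      q = length I′
      r = reversalSign q
      d = D after I ks
      column≈0 : All (λ i → after i (inj₂ n) ≈ 0#) (downFrom n)
      column≈0 = All.map
        (λ i<n → trans (*-congˡ (reflexive (toeplitz-upper δ i<n))) (zeroʳ (ε n))) (downFrom-< n)

    -- The columns taken are J of the left block and I′ of the right. Expansion leaves rows J′ and
    -- columns I′ of `before`, rows I and columns J of `after`. The two reversal signs agree and
    -- cancel, I′ and J′ being equally long.
    complementaryMinors : ∀ {n I I′ J J′} → Complementary n I I′ → Complementary n J J′ →
                          length I ≡ length J → length I′ ≡ length J′ →
                          D (toeplitz (monic z)) I J ≈ D (toeplitz e) J′ I′
    complementaryMinors {n} {I} {I′} {J} {J′} cI cJ eq eq′ = begin
      D (toeplitz (monic z)) I J
        ≈⟨ D-map after inj₁ I J ⟨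
      D after I (map inj₁ J)
        ≈⟨ *-identityˡ _ ⟨
      1# * D after I (map inj₁ J)
        ≈⟨ *-congʳ (reversalSign-square (length I′)) ⟨
      (r * r) * D after I (map inj₁ J)
        ≈⟨ *-assoc _ _ _ ⟩
      r * (r * D after I (map inj₁ J))
        ≈⟨ *-congˡ (D-after cI (map inj₁ J) (≡.trans (length-map inj₁ J) (≡.sym eq))) ⟨
      r * D after (downFrom n) (map inj₁ J ++ map inj₂ I′)
        ≈⟨ *-congˡ (D-after-before n (map inj₁ J ++ map inj₂ I′)) ⟩
      r * D before (downFrom n) (map inj₁ J ++ map inj₂ I′)
        ≈⟨ *-congˡ (D-before cJ (map inj₂ I′)) ⟩
      r * (reversalSign (length J′) * D scaled J′ (map inj₂ I′))
        ≡⟨ ≡.cong (λ n → r * (reversalSign n * D scaled J′ (map inj₂ I′))) eq′ ⟨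
      r * (r * D scaled J′ (map inj₂ I′))
        ≈⟨ *-assoc _ _ _ ⟨
      (r * r) * D scaled J′ (map inj₂ I′)
        ≈⟨ *-cong (reversalSign-square (length I′)) (D-map scaled inj₂ J′ I′) ⟩
      1# * D (λ i j → scaled i (inj₂ j)) J′ I′
        ≈⟨ *-identityˡ _ ⟩
      D (λ i j → scaled i (inj₂ j)) J′ I′
        ≈⟨ D-cong (toeplitz-ε e) J′ I′ ⟩
      D (toeplitz e) J′ I′ ∎
      where r = reversalSign (length I′)

-- Partitions as lattice paths.

nth-≥-length : ∀ ps {i} → length ps ≤ i → nth ps i ≡ 0
nth-≥-length []       _         = ≡.refl
nth-≥-length (p ∷ ps) (s≤s n≤i) = nth-≥-length ps n≤i

nth-positive⁻ : ∀ ps {i} → 0 < nth ps i → i < length ps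
nth-positive⁻ (p ∷ ps) {zero}  _ = s≤s z≤n
nth-positive⁻ (p ∷ ps) {suc i} 0<pᵢ = s≤s (nth-positive⁻ ps 0<pᵢ)

nth-positive⁺ : ∀ {ps i} → All (0 <_) ps → i < length ps → 0 < nth ps i
nth-positive⁺ {i = zero}  (0<p ∷ _)   _         = 0<p
nth-positive⁺ {i = suc i} (_   ∷ 0<ps) (s≤s i<n) = nth-positive⁺ 0<ps i<n

nth-decreasing : ∀ {ps} → Linked _≥_ ps → ∀ i → nth ps (suc i) ≤ nth ps i
nth-decreasing []          i       = z≤n
nth-decreasing [-]         i       = z≤n
nth-decreasing (q≤p ∷ _)   zero    = q≤p
nth-decreasing (_   ∷ qs)  (suc i) = nth-decreasing qs i

column-≤ : ∀ {ps qs} → Linked _≥_ ps → Linked _≥_ qs → (∀ i → nth ps i ≤ nth qs i) →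
           ∀ j → column ps j ≤ column qs j
column-≤ ↘ps ↘qs p≤q j = ≤-from-< (λ i i<c →
  column⁺ ↘qs i j (<-≤-trans (column⁻ ↘ps i j i<c) (p≤q i)))

column-≤-length : ∀ ps j → column ps j ≤ length ps
column-≤-length ps j = length-filter (j <?_) ps

column-zero : ∀ {ps} → Linked _≥_ ps → ∀ {j} → nth ps 0 ≤ j → column ps j ≡ 0
column-zero {[]}     ↘ps p≤j = ≡.refl
column-zero {p ∷ ps} ↘ps p≤j = column-reject ↘ps (≤⇒≯ p≤j)

applyDownFrom-cong : ∀ {A : Set} {f g : ℕ → A} n → (∀ {i} → i < n → f i ≡ g i) →
                     applyDownFrom f n ≡ applyDownFrom g n
applyDownFrom-cong zero    f≡g = ≡.refl
applyDownFrom-cong (suc n) f≡g = ≡.cong₂ _∷_ (f≡g ≤-refl) (applyDownFrom-cong n (f≡g ∘ m<n⇒m<1+n))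

applyUpTo-tabulate : ∀ {A : Set} (f : ℕ → A) n → applyUpTo f n ≡ tabulate {n = n} (f ∘ toℕ)
applyUpTo-tabulate f zero    = ≡.refl
applyUpTo-tabulate f (suc n) = ≡.cong (f 0 ∷_) (applyUpTo-tabulate (f ∘ suc) n)

-- The south-east boundary of a diagram in a box with k rows and m columns is
-- a lattice path of m + k steps; numbered from the south-west corner, its
-- vertical steps are `verticals` and its horizontal steps `horizontal`.
verticals : List ℕ → List ℕ
verticals []       = []
verticals (p ∷ ps) = p ℕ.+ length ps ∷ verticals ps

horizontal : List ℕ → ℕ → ℕ
horizontal ps j = length ps ∸ column ps j ℕ.+ j

-- The path is followed back from its north-east end, which has the largest number. If the first row
-- falls short of the box, the last step is horizontal and a column is removed; otherwise it is
-- vertical and the first row is removed. `boundary-step` is the former case, shared with the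
-- diagram without rows.
boundary : ∀ ps m → Linked _≥_ ps → nth ps 0 ≤ m →
           Complementary (m ℕ.+ length ps) (verticals ps) (applyDownFrom (horizontal ps) m)
boundary-step : ∀ ps m → Linked _≥_ ps → nth ps 0 ≤ m →
                Complementary (suc m ℕ.+ length ps) (verticals ps) (applyDownFrom (horizontal ps) (suc m))

boundary []       zero    ↘ps p≤m = []
boundary []       (suc m) ↘ps p≤m = boundary-step [] m ↘ps z≤n
boundary (p ∷ ps) m       ↘ps p≤m with m≤n⇒m<n∨m≡n p≤m
... | inj₁ (s≤s p≤m′)  = boundary-step (p ∷ ps) _ ↘ps p≤m′
-- Every column `j < p` loses one cell together with the row, so the horizontal labels are
-- unchanged.
... | inj₂ ≡.refl = ≡.subst₂ (λ n → Complementary n (verticals (p ∷ ps)))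
  (≡.sym (ℕ.+-suc p (length ps)))
  (applyDownFrom-cong p (λ {j} j<p →
    ≡.cong (λ c → suc (length ps) ∸ c ℕ.+ j) (≡.sym (column-accept {ps = ps} j<p))))
  (inˡ (boundary ps p (Linked.tail ↘ps) (nth-head ↘ps 1)))

boundary-step ps m ↘ps p≤m =
  ≡.subst (λ i → Complementary (suc m ℕ.+ length ps) (verticals ps) (i ∷ applyDownFrom (horizontal ps) m))
    (≡.trans (ℕ.+-comm m (length ps))
      (≡.cong (λ c → length ps ∸ c ℕ.+ m) (≡.sym (column-zero ↘ps p≤m))))
    (inʳ (boundary ps m ↘ps p≤m))

verticals-applyUpTo : ∀ f k → verticals (applyUpTo f k) ≡ applyUpTo (λ i → f i ℕ.+ (k ∸ suc i)) k
verticals-applyUpTo f zero    = ≡.refl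
verticals-applyUpTo f (suc k) = ≡.cong₂ _∷_
  (≡.cong (f 0 ℕ.+_) (length-applyUpTo (f ∘ suc) k)) (verticals-applyUpTo (f ∘ suc) k)

module _ (σ : Partition) (k : ℕ) where

  -- `verticalᵖ` lists the beta numbers λᵢ + k - i, counted from i = 1. As k may exceed the length,
  -- which happens for μ in the box of λ, `boundaryᵖ` pads with zero parts.
  verticalᵖ horizontalᵖ : ℕ → ℕ
  verticalᵖ   i = part σ i ℕ.+ (k ∸ suc i)
  horizontalᵖ j = k ∸ column (parts σ) j ℕ.+ j

  boundaryᵖ : ∀ m → ℓ σ ≤ k → part σ 0 ≤ m →
              Complementary (m ℕ.+ k) (applyUpTo verticalᵖ k) (applyDownFrom horizontalᵖ m)
  boundaryᵖ m ℓ≤k σ₀≤m = ≡.subst₂ (Complementary (m ℕ.+ k))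
    (verticals-applyUpTo (part σ) k)
    (applyDownFrom-cong m (λ {j} _ → ≡.cong₂ (λ l c → l ∸ c ℕ.+ j) (length-applyUpTo (part σ) k) (column-padded j)))
    (≡.subst (λ l → Complementary (m ℕ.+ l) (verticals padded) (applyDownFrom (horizontal padded) m))
      (length-applyUpTo (part σ) k)
      (boundary padded m ↘padded (≤-trans (≤-reflexive (nth-padded 0)) σ₀≤m)))
    where
    padded = applyUpTo (part σ) k
    nth-padded : ∀ i → nth padded i ≡ part σ i
    nth-padded = nth-applyUpTo (part σ) k (λ j k≤j → nth-≥-length (parts σ) (≤-trans ℓ≤k k≤j))
    ↘padded : Linked _≥_ padded
    ↘padded = Linked.applyUpTo⁺₂ (part σ) k (nth-decreasing (decreasing σ))
    column-padded : ∀ j → column padded j ≡ column (parts σ) j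
    column-padded j = ≤-antisym
      (column-≤ ↘padded (decreasing σ) (≤-reflexive ∘ nth-padded) j)
      (column-≤ (decreasing σ) ↘padded (≤-reflexive ∘ ≡.sym ∘ nth-padded) j)

ℓ-≤ : ∀ θ → ℓ (inner θ) ≤ ℓ (outer θ)
ℓ-≤ θ = ≤-from-< (λ i i<ℓ → nth-positive⁻ (parts (outer θ))
  (<-≤-trans (nth-positive⁺ (positive (inner θ)) i<ℓ) (contained θ i)))

-- The hypothesis is the equation a - b - i + j = u - v with the negative terms moved across, so
-- that it can be checked in `ℕ`.
ℤ-difference : ∀ a b i j u v → a ℕ.+ j ℕ.+ v ≡ b ℕ.+ i ℕ.+ u →
               + a ℤ.- + b ℤ.- + i ℤ.+ + j ≡ u ⊖ v
ℤ-difference a b i j u v eq = begin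
  + a ℤ.- + b ℤ.- + i ℤ.+ + j
    ≡⟨ ℤsolve 5 (λ a b i j v → a ∶- b ∶- i ∶+ j ∶= (a ∶+ j ∶+ v) ∶- (b ∶+ i) ∶- v) ≡.refl (+ a) (+ b) (+ i) (+ j) (+ v) ⟩
  + (a ℕ.+ j ℕ.+ v) ℤ.- (+ b ℤ.+ + i) ℤ.- + v
    ≡⟨ ≡.cong (λ n → + n ℤ.- (+ b ℤ.+ + i) ℤ.- + v) eq ⟩
  + (b ℕ.+ i ℕ.+ u) ℤ.- (+ b ℤ.+ + i) ℤ.- + v
    ≡⟨ ℤsolve 4 (λ b i u v → (b ∶+ i ∶+ u) ∶- (b ∶+ i) ∶- v ∶= u ∶- v) ≡.refl (+ b) (+ i) (+ u) (+ v) ⟩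
  + u ℤ.- + v
    ≡⟨ ℤ.m-n≡m⊖n u v ⟩
  u ⊖ v ∎
  where
  open ≡.≡-Reasoning
  open ℤSolver.+-*-Solver using () renaming
    (solve to ℤsolve; _:+_ to _∶+_; _:-_ to _∶-_; _:=_ to _∶=_)

-- Skew Schur functions as Toeplitz minors.

module SkewSchur {c ℓ₁} (R : CommutativeRing c ℓ₁) where
  open CommutativeRing R hiding (zero)
  open Determinants R
  open Toeplitz R
  open import Relation.Binary.Reasoning.Setoid setoid

  coefficient : (ℕ → Carrier) → ℤ → Carrier
  coefficient z (+ n)    = monic z n
  coefficient z -[1+ n ] = 0#

  schur : (ℕ → Carrier) → SkewPartition → Carrier
  schur z θ = det R λ (i j : Fin (ℓ (outer θ))) →
    coefficient z (+ part (outer θ) (toℕ i) ℤ.- + part (inner θ) (toℕ j) ℤ.- + toℕ i ℤ.+ + toℕ j)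

  coefficient-⊖ : ∀ z i j → coefficient z (i ⊖ j) ≡ toeplitz (monic z) i j
  coefficient-⊖ z i       zero    = ≡.refl
  coefficient-⊖ z zero    (suc j) = ≡.refl
  coefficient-⊖ z (suc i) (suc j) =
    ≡.trans (≡.cong (coefficient z) (ℤ.[1+m]⊖[1+n]≡m⊖n i j)) (coefficient-⊖ z i j)

  coefficient-toeplitz : ∀ z a b i j u v → a ℕ.+ j ℕ.+ v ≡ b ℕ.+ i ℕ.+ u →
    coefficient z (+ a ℤ.- + b ℤ.- + i ℤ.+ + j) ≈ toeplitz (monic z) u v
  coefficient-toeplitz z a b i j u v eq = reflexive
    (≡.trans (≡.cong (coefficient z) (ℤ-difference a b i j u v eq)) (coefficient-⊖ z u v))

  module _ (θ : SkewPartition) where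
    private
      k = ℓ (outer θ)
      m = part (outer θ) 0

    schur-verticals : ∀ z → schur z θ ≈
      D (toeplitz (monic z)) (applyUpTo (verticalᵖ (outer θ) k) k) (applyUpTo (verticalᵖ (inner θ) k) k)
    schur-verticals z = trans
      (det-D (toeplitz (monic z)) _ (verticalᵖ (outer θ) k ∘ toℕ) (verticalᵖ (inner θ) k ∘ toℕ) (λ i j →
        coefficient-toeplitz z (part (outer θ) (toℕ i)) (part (inner θ) (toℕ j)) (toℕ i) (toℕ j) _ _
          (balance (part (outer θ) (toℕ i)) (part (inner θ) (toℕ j)) (toℕ<n i) (toℕ<n j))))
      (reflexive (≡.sym (≡.cong₂ (D (toeplitz (monic z)))
        (applyUpTo-tabulate (verticalᵖ (outer θ) k) k) (applyUpTo-tabulate (verticalᵖ (inner θ) k) k))))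
      where
      balance : ∀ a b {i j} → i < k → j < k →
                a ℕ.+ j ℕ.+ (b ℕ.+ (k ∸ suc j)) ≡ b ℕ.+ i ℕ.+ (a ℕ.+ (k ∸ suc i))
      balance a b {i} {j} i<k j<k = suc-injective (≡.trans
        (ℕsolve 4 (λ a b j x → ℕlit 1 ∔ (a ∔ j ∔ (b ∔ x)) ≐ a ∔ b ∔ (ℕlit 1 ∔ j ∔ x)) ≡.refl a b j (k ∸ suc j))
        (≡.trans (≡.cong (a ℕ.+ b ℕ.+_) (≡.trans (m+[n∸m]≡n j<k) (≡.sym (m+[n∸m]≡n i<k))))
          (ℕsolve 4 (λ a b i x → a ∔ b ∔ (ℕlit 1 ∔ i ∔ x) ≐ ℕlit 1 ∔ (b ∔ i ∔ (a ∔ x))) ≡.refl a b i (k ∸ suc i))))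

    -- Horizontal labels are k - λᵗᵢ + i, so λᵗᵢ - μᵗⱼ - i + j is a label of μ minus one of λ; hence
    -- the transposed Toeplitz matrix.
    schur-horizontals : ∀ z → schur z (θ ᵗˢ) ≈
      D (flip (toeplitz (monic z))) (applyUpTo (horizontalᵖ (outer θ) k) m) (applyUpTo (horizontalᵖ (inner θ) k) m)
    schur-horizontals z = trans
      (det-D (flip (toeplitz (monic z))) {ℓ (outer θ ᵗ)} _ (horizontalᵖ (outer θ) k ∘ toℕ) (horizontalᵖ (inner θ) k ∘ toℕ) (λ i j →
        coefficient-toeplitz z (part (outer θ ᵗ) (toℕ i)) (part (inner θ ᵗ) (toℕ j)) (toℕ i) (toℕ j) _ _
          (balance (toℕ i) (toℕ j) (part-ᵗ (outer θ) (toℕ i)) (part-ᵗ (inner θ) (toℕ j))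
            (column-≤-length (parts (outer θ)) (toℕ i))
            (≤-trans (column-≤-length (parts (inner θ)) (toℕ j)) (ℓ-≤ θ)))))
      (reflexive (≡.sym (≡.trans
        (≡.cong (λ n → D (flip (toeplitz (monic z))) (applyUpTo (horizontalᵖ (outer θ) k) n) (applyUpTo (horizontalᵖ (inner θ) k) n))
          (≡.sym (length-applyUpTo (column (parts (outer θ))) m)))
        (≡.cong₂ (D (flip (toeplitz (monic z))))
          (applyUpTo-tabulate (horizontalᵖ (outer θ) k) (ℓ (outer θ ᵗ)))
          (applyUpTo-tabulate (horizontalᵖ (inner θ) k) (ℓ (outer θ ᵗ)))))))
      where
      balance : ∀ {a a′ b b′} i j → a ≡ a′ → b ≡ b′ → a′ ≤ k → b′ ≤ k →
                a ℕ.+ j ℕ.+ (k ∸ a′ ℕ.+ i) ≡ b ℕ.+ i ℕ.+ (k ∸ b′ ℕ.+ j)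
      balance {a} {b = b} i j ≡.refl ≡.refl a≤k b≤k = ≡.trans
        (ℕsolve 4 (λ a i j x → a ∔ j ∔ (x ∔ i) ≐ (a ∔ x) ∔ (i ∔ j)) ≡.refl a i j (k ∸ a))
        (≡.trans (≡.cong (ℕ._+ (i ℕ.+ j)) (≡.trans (m+[n∸m]≡n a≤k) (≡.sym (m+[n∸m]≡n b≤k))))
          (ℕsolve 4 (λ b i j x → (b ∔ x) ∔ (i ∔ j) ≐ b ∔ i ∔ (x ∔ j)) ≡.refl b i j (k ∸ b)))

    -- The hypothesis says that the series of `w` at -t is inverse to the series of `z`. Jacobi's
    -- identity delivers the horizontal labels decreasingly and with μ on the rows; transposing and
    -- reversing both lists repairs this.
    schur-ᵗ : ∀ z w → (∀ n → δ n ≈ ε n * monic w n + conv z (λ i → ε i * monic w i) n) →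
              schur z θ ≈ schur w (θ ᵗˢ)
    schur-ᵗ z w inverse = begin
      schur z θ
        ≈⟨ schur-verticals z ⟩
      D (toeplitz (monic z)) (applyUpTo vλ k) (applyUpTo vμ k)
        ≈⟨ complementaryMinors z (monic w) inverse
             (boundaryᵖ (outer θ) k m ≤-refl ≤-refl)
             (boundaryᵖ (inner θ) k m (ℓ-≤ θ) (contained θ 0))
             (≡.trans (length-applyUpTo vλ k) (≡.sym (length-applyUpTo vμ k)))
             (≡.trans (length-applyDownFrom hλ m) (≡.sym (length-applyDownFrom hμ m))) ⟩
      D (toeplitz (monic w)) (applyDownFrom hμ m) (applyDownFrom hλ m)
        ≈⟨ D-transpose (toeplitz (monic w)) (applyDownFrom hμ m) (applyDownFrom hλ m) ⟩
      D (flip (toeplitz (monic w))) (applyDownFrom hλ m) (applyDownFrom hμ m)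
        ≡⟨ ≡.cong₂ (D (flip (toeplitz (monic w)))) (reverse-applyUpTo hλ m) (reverse-applyUpTo hμ m) ⟨
      D (flip (toeplitz (monic w))) (reverse (applyUpTo hλ m)) (reverse (applyUpTo hμ m))
        ≈⟨ D-reverse (flip (toeplitz (monic w))) (applyUpTo hλ m) (applyUpTo hμ m)
             (≡.trans (length-applyUpTo hλ m) (≡.sym (length-applyUpTo hμ m))) ⟩
      D (flip (toeplitz (monic w))) (applyUpTo hλ m) (applyUpTo hμ m)
        ≈⟨ schur-horizontals w ⟨
      schur w (θ ᵗˢ) ∎
      where
      vλ = verticalᵖ (outer θ) k
      vμ = verticalᵖ (inner θ) k
      hλ = horizontalᵖ (outer θ) k
      hμ = horizontalᵖ (inner θ) k

-- The elementary sequence of a given complete one.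

module ElementarySequence {c₁ ℓ₁} (R : CommutativeRing c₁ ℓ₁) where
  open CommutativeRing R hiding (zero)
  open IntegerMultiples R using (solve; _:=_; lit; _⊕_; _⊗_; _⊝_; ⊟_)
  open Determinants R
  open Toeplitz R
  open import Relation.Binary.Reasoning.Setoid setoid

  -- z₀eₙ - z₁eₙ₋₁ + ⋯ + (-1)ⁿ x, the next coefficient of 1/H(-t), from the
  -- lists z₀, …, zₙ₋₁ and eₙ, …, e₁, e₀ and the value x of zₙ.
  next : List Carrier → List Carrier → Carrier → Carrier
  next []       es       x = x
  next (z ∷ zs) []       x = x
  next (z ∷ zs) (e ∷ es) x = z * e - next zs es x

  elementaries : (ℕ → Carrier) → ℕ → List Carrier
  elementary   : (ℕ → Carrier) → ℕ → Carrier
  elementaries z zero    = 1# ∷ []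
  elementaries z (suc n) = elementary z n ∷ elementaries z n
  elementary z n = next (applyUpTo z n) (elementaries z n) (z n)

  elementaries-applyDownFrom : ∀ z n →
    elementaries z n ≡ applyDownFrom (monic (elementary z)) (suc n)
  elementaries-applyDownFrom z zero    = ≡.refl
  elementaries-applyDownFrom z (suc n) = ≡.cong (elementary z n ∷_) (elementaries-applyDownFrom z n)

  -- Both sides are Σ (-1)ⁱ zᵢ aₙ₋ᵢ, except that `next` ends in the bare `z n` where the convolution
  -- has `z n * a 0`; hence the condition on `a 0`.
  next-conv : ∀ z a n → a 0 ≈ 1# →
              next (applyUpTo z n) (applyDownFrom a (suc n)) (z n) ≈ ε n * conv z (λ i → ε i * a i) (suc n)
  next-conv z a zero a₀≈1 = begin
    z 0                                      ≈⟨ solve 1 (λ z → z := lit 1ℤ ⊗ (z ⊗ (lit 1ℤ ⊗ lit 1ℤ) ⊕ lit 0ℤ)) refl (z 0) ⟩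
    1# * (z 0 * (1# * 1#) + 0#)              ≈⟨ *-congˡ (+-congʳ (*-congˡ (*-congˡ a₀≈1))) ⟨
    1# * (z 0 * (1# * a 0) + 0#)             ∎
  next-conv z a (suc n) a₀≈1 = begin
    z 0 * a (suc n) - next (applyUpTo (z ∘ suc) n) (applyDownFrom a (suc n)) (z (suc n))
      ≈⟨ +-congˡ (-‿cong (next-conv (z ∘ suc) a n a₀≈1)) ⟩
    z 0 * a (suc n) - ε n * c
      ≈⟨ +-congʳ (*-identityˡ _) ⟨
    1# * (z 0 * a (suc n)) - ε n * c
      ≈⟨ +-congʳ (*-congʳ (ε-square (suc n))) ⟨
    (ε (suc n) * ε (suc n)) * (z 0 * a (suc n)) - ε n * c
      ≈⟨ solve 4 (λ e z a c → (((⊟ lit 1ℤ) ⊗ e) ⊗ ((⊟ lit 1ℤ) ⊗ e)) ⊗ (z ⊗ a) ⊝ e ⊗ c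
                     := ((⊟ lit 1ℤ) ⊗ e) ⊗ (z ⊗ (((⊟ lit 1ℤ) ⊗ e) ⊗ a) ⊕ c)) refl (ε n) (z 0) (a (suc n)) c ⟩
    ε (suc n) * (z 0 * (ε (suc n) * a (suc n)) + c) ∎
    where c = conv (z ∘ suc) (λ i → ε i * a i) (suc n)

  elementary-inverse : ∀ z n →
    δ n ≈ ε n * monic (elementary z) n + conv z (λ i → ε i * monic (elementary z) i) n
  elementary-inverse z zero    = solve 0 (lit 1ℤ := lit 1ℤ ⊗ lit 1ℤ ⊕ lit 0ℤ) refl
  elementary-inverse z (suc n) = begin
    0#
      ≈⟨ solve 1 (λ c → lit 0ℤ := (⊟ c) ⊕ c) refl c ⟩
    - c + c
      ≈⟨ +-congʳ (-‿cong (*-identityˡ c)) ⟨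
    - (1# * c) + c
      ≈⟨ +-congʳ (-‿cong (*-congʳ (ε-square n))) ⟨
    - ((ε n * ε n) * c) + c
      ≈⟨ +-congʳ (solve 2 (λ e c → ⊟ ((e ⊗ e) ⊗ c) := ((⊟ lit 1ℤ) ⊗ e) ⊗ (e ⊗ c)) refl (ε n) c) ⟩
    ε (suc n) * (ε n * c) + c
      ≈⟨ +-congʳ (*-congˡ (next-conv z (monic (elementary z)) n refl)) ⟨
    ε (suc n) * next (applyUpTo z n) (applyDownFrom (monic (elementary z)) (suc n)) (z n) + c
      ≡⟨ ≡.cong (λ es → ε (suc n) * next (applyUpTo z n) es (z n) + c) (elementaries-applyDownFrom z n) ⟨
    ε (suc n) * elementary z n + c ∎
    where c = conv z (λ i → ε i * monic (elementary z) i) (suc n)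

  -- The elementary sequence as a transducer: `zs` holds the inputs read, `es` the outputs so far,
  -- newest first. `total` peels off one coordinate at a time, and this state lets an induction keep
  -- pace with it.
  run : List Carrier → List Carrier → (ℕ → Carrier) → ℕ → Carrier
  run zs es z zero    = next zs es (z 0)
  run zs es z (suc n) = run (zs ∷ʳ z 0) (next zs es (z 0) ∷ es) (z ∘ suc) n

  run-elementary : ∀ z n w → (∀ i → w i ≡ z (n ℕ.+ i)) →
                   ∀ i → run (applyUpTo z n) (elementaries z n) w i ≡ elementary z (n ℕ.+ i)
  run-elementary z n w w≡ zero rewrite w≡ 0 | ℕ.+-identityʳ n = ≡.refl
  run-elementary z n w w≡ (suc i) rewrite w≡ 0 | ℕ.+-identityʳ n | applyUpTo-∷ʳ z n | ℕ.+-suc n i =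
    run-elementary z (suc n) (w ∘ suc) (λ j → ≡.trans (w≡ (suc j)) (≡.cong z (ℕ.+-suc n j))) i

  run-◂ : ∀ zs es x z i →
          run zs es (x ◂ z) i ≡ (next zs es x ◂ run (zs ∷ʳ x) (next zs es x ∷ es) z) i
  run-◂ zs es x z zero    = ≡.refl
  run-◂ zs es x z (suc i) = ≡.refl

-- Counting points over a finite field.

indicator : ∀ {p} {P : Set p} → Dec P → ℕ
indicator (yes _) = 1
indicator (no  _) = 0

indicator-⇔ : ∀ {p q} {P : Set p} {Q : Set q} (P? : Dec P) (Q? : Dec Q) →
              (P → Q) → (Q → P) → indicator P? ≡ indicator Q?
indicator-⇔ (yes p) (yes q) f g = ≡.refl
indicator-⇔ (yes p) (no ¬q) f g = contradiction (f p) ¬q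
indicator-⇔ (no ¬p) (yes q) f g = contradiction (g q) ¬p
indicator-⇔ (no ¬p) (no ¬q) f g = ≡.refl

length-filter-map : ∀ {a b p} {A : Set a} {B : Set b} {P : B → Set p} (P? : ∀ y → Dec (P y)) (f : A → B) xs →
                    length (filter P? (map f xs)) ≡ length (filter (P? ∘ f) xs)
length-filter-map P? f []       = ≡.refl
length-filter-map P? f (x ∷ xs) with P? (f x)
... | yes _ = ≡.cong suc (length-filter-map P? f xs)
... | no  _ = length-filter-map P? f xs

length-filter-product : ∀ {a b d p} {A : Set a} {B : Set b} {D : Set d} {P : D → Set p}
  (P? : ∀ y → Dec (P y)) (_∙_ : A → B → D) {m} (f : Fin m → A) {n} (κ : Fin n → Fin m) ys →
  length (filter P? (cartesianProductWith _∙_ (map f (tabulate κ)) ys)) ≡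
  sumℕ (λ i → length (filter (λ y → P? (f (κ i) ∙ y)) ys))
length-filter-product P? _∙_ f {zero}  κ ys = ≡.refl
length-filter-product P? _∙_ f {suc n} κ ys = ≡.trans
  (≡.cong length (filter-++ P? (map (f (κ zero) ∙_) ys) _))
  (≡.trans (length-++ (filter P? (map (f (κ zero) ∙_) ys)))
    (≡.cong₂ ℕ._+_ (length-filter-map P? (f (κ zero) ∙_) ys) (length-filter-product P? _∙_ f (κ ∘ suc) ys)))

/-cong : ∀ {a b c d} .{{_ : NonZero b}} .{{_ : NonZero d}} → a ℕ.* d ≡ c ℕ.* b → (+ a) ℚ./ b ≡ (+ c) ℚ./ d
/-cong {a} {suc b} {c} {suc d} eq = ℚ.fromℚᵘ-cong {mkℚᵘ (+ a) b} {mkℚᵘ (+ c) d} (*≡*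
  (≡.trans (≡.sym (ℤ.pos-* a (suc d))) (≡.trans (≡.cong +_ eq) (ℤ.pos-* c (suc b)))))

module Counting {q c ℓ₁} (F : FiniteField q c ℓ₁) where
  open FiniteField F hiding (zero)
  open Inverse enumeration using (to; from; to-cong; strictlyInverseˡ; strictlyInverseʳ)
  open IntegerMultiples commutativeRing using (solve; _:=_; _⊝_)
  open ElementarySequence commutativeRing using (next; run; run-◂)

  -- The sum of φ over z₀, …, z_{N-1} ∈ F, the other zᵢ being 0.
  total : ℕ → ((ℕ → Carrier) → ℕ) → ℕ
  total zero    φ = φ (λ _ → 0#)
  total (suc N) φ = sumℕ (λ i → total N (λ z → φ (from i ◂ z)))

  total-cong : ∀ N {φ ψ} → (∀ z → φ z ≡ ψ z) → total N φ ≡ total N ψ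
  total-cong zero    φ≡ψ = φ≡ψ _
  total-cong (suc N) φ≡ψ = sum-cong-≗ (λ i → total-cong N (λ z → φ≡ψ (from i ◂ z)))

  -- Two conditions in one: coordinates from `N` on do not affect `φ`, and `φ` respects `≈` in the
  -- others. The latter permits reindexing through the enumeration, which recovers elements only up
  -- to `≈`.
  DependsOn : ℕ → ((ℕ → Carrier) → ℕ) → Set _
  DependsOn N φ = ∀ z w → (∀ {i} → i < N → z i ≈ w i) → φ z ≡ φ w

  ◂-cong : ∀ {N x y} {z w : ℕ → Carrier} → x ≈ y → (∀ {i} → i < N → z i ≈ w i) →
           ∀ {i} → i < suc N → (x ◂ z) i ≈ (y ◂ w) i
  ◂-cong x≈y z≈w {zero}  _         = x≈y
  ◂-cong x≈y z≈w {suc i} (s≤s i<N) = z≈w i<N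

  DependsOn-◂ : ∀ {N φ} → DependsOn (suc N) φ → ∀ x → DependsOn N (λ z → φ (x ◂ z))
  DependsOn-◂ dep x z w z≈w = dep (x ◂ z) (x ◂ w) (◂-cong refl z≈w)

  total-cong-◂ : ∀ {N φ} → DependsOn (suc N) φ → ∀ {x y} → x ≈ y →
                 total N (λ z → φ (x ◂ z)) ≡ total N (λ z → φ (y ◂ z))
  total-cong-◂ {N} dep {x} {y} x≈y =
    total-cong N (λ z → dep (x ◂ z) (y ◂ z) (◂-cong x≈y (λ _ → refl)))

  total-constant : ∀ L {φ} → DependsOn 0 φ → total L φ ≡ φ (λ _ → 0#) ℕ.* q ℕ.^ L
  total-constant zero    {φ} dep = ≡.sym (ℕ.*-identityʳ (φ _))
  total-constant (suc L) {φ} dep = ≡.trans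
    (sum-cong-≗ {q} (λ i → ≡.trans
      (total-constant L (λ z w _ → dep (from i ◂ z) (from i ◂ w) (λ ())))
      (≡.cong (ℕ._* q ℕ.^ L) (dep (from i ◂ λ _ → 0#) (λ _ → 0#) (λ ())))))
    (≡.trans (sum-constant q (φ₀ ℕ.* q ℕ.^ L))
      (ℕsolve 3 (λ q f p → q ⊛ (f ⊛ p) ≐ f ⊛ (q ⊛ p)) ≡.refl q φ₀ (q ℕ.^ L)))
    where
    φ₀ = φ (λ _ → 0#)
    sum-constant : ∀ n k → sumℕ {n} (λ _ → k) ≡ n ℕ.* k
    sum-constant zero    k = ≡.refl
    sum-constant (suc n) k = ≡.cong (k ℕ.+_) (sum-constant n k)

  total-extend : ∀ M L {φ} → DependsOn M φ → total (M ℕ.+ L) φ ≡ total M φ ℕ.* q ℕ.^ L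
  total-extend zero    L dep = total-constant L dep
  total-extend (suc M) L {φ} dep = ≡.trans
    (sum-cong-≗ (λ i → total-extend M L (DependsOn-◂ dep (from i))))
    (≡.sym (*-distribʳ-sum {q} (q ℕ.^ L) (λ i → total M (λ z → φ (from i ◂ z)))))

  -- The map x ↦ k - x is an involution; carried to `Fin q` it is a permutation that is its own
  -- inverse.
  sum-reflect : ∀ (f : Carrier → ℕ) → (∀ {x y} → x ≈ y → f x ≡ f y) → ∀ k →
                sumℕ (λ i → f (k - from i)) ≡ sumℕ (λ i → f (from i))
  sum-reflect f f-cong k = ≡.sym (≡.trans (sum-permute (f ∘ from) (permutation π π involutive involutive))
    (sum-cong-≗ (λ i → f-cong (strictlyInverseʳ (k - from i)))))
    where
    π : Fin q → Fin q
    π i = to (k - from i)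
    involutive : ∀ i → π (π i) ≡ i
    involutive i = ≡.trans
      (to-cong (trans (+-congˡ (-‿cong (strictlyInverseʳ (k - from i))))
        (solve 2 (λ k x → k ⊝ (k ⊝ x) := x) refl k (from i))))
      (strictlyInverseˡ i)

  -- `next zs es` is a composite of reflections x ↦ ze - x, ending in the identity when either list
  -- is exhausted; the outermost reflection is absorbed into `f`.
  sum-next : ∀ zs es (f : Carrier → ℕ) → (∀ {x y} → x ≈ y → f x ≡ f y) →
             sumℕ (λ i → f (next zs es (from i))) ≡ sumℕ (λ i → f (from i))
  sum-next []       es       f f-cong = ≡.refl
  sum-next (z ∷ zs) []       f f-cong = ≡.refl
  sum-next (z ∷ zs) (e ∷ es) f f-cong = ≡.trans
    (sum-next zs es (λ x → f (z * e - x)) (λ x≈y → f-cong (+-congˡ (-‿cong x≈y))))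
    (sum-reflect f f-cong (z * e))

  -- For fixed z₀, …, zₙ₋₁, the n-th output of run is an affine bijection of zₙ.
  total-run : ∀ N zs es {φ} → DependsOn N φ → total N (φ ∘ run zs es) ≡ total N φ
  total-run zero    zs es dep = dep _ _ (λ ())
  total-run (suc N) zs es {φ} dep = ≡.trans
    (sum-cong-≗ (λ i → ≡.trans
      (total-cong N (λ z → dep _ _ (λ {j} _ → reflexive (run-◂ zs es (from i) z j))))
      (total-run N (zs ∷ʳ from i) (next zs es (from i) ∷ es) (DependsOn-◂ dep (next zs es (from i))))))
    (sum-next zs es (λ x → total N (λ z → φ (x ◂ z))) (total-cong-◂ {N} dep))

  extend : ∀ {N} → Vec Carrier N → ℕ → Carrier
  extend []       = λ _ → 0#
  extend (x ∷ xs) = x ◂ extend xs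

  lookup-extend : ∀ {N} (xs : Vec Carrier N) i → lookup xs i ≡ extend xs (toℕ i)
  lookup-extend (x ∷ xs) zero    = ≡.refl
  lookup-extend (x ∷ xs) (suc i) = lookup-extend xs i

  length-filter-points : ∀ N {p} {Q : Vec Carrier N → Set p} (Q? : ∀ xs → Dec (Q xs)) φ →
                         (∀ xs → indicator (Q? xs) ≡ φ (extend xs)) →
                         length (filter Q? (points F N)) ≡ total N φ
  length-filter-points zero Q? φ Q?≡φ = ≡.trans count≡ (Q?≡φ [])
    where
    count≡ : length (filter Q? ([] ∷ [])) ≡ indicator (Q? [])
    count≡ with Q? []
    ... | yes _ = ≡.refl
    ... | no  _ = ≡.refl
  length-filter-points (suc N) Q? φ Q?≡φ = ≡.trans
    (length-filter-product Q? _∷_ from (λ i → i) (points F N))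
    (sum-cong-≗ (λ i → length-filter-points N (λ xs → Q? (from i ∷ xs)) (λ z → φ (from i ◂ z))
      (λ xs → Q?≡φ (from i ∷ xs))))

-- Evaluation of polynomials and of their determinants.

module Evaluation {q c ℓ₁} (F : FiniteField q c ℓ₁) where
  open FiniteField F hiding (zero)
  open IntegerMultiples commutativeRing using (⟦_⟧; ⟦⟧-homo-+; ⟦⟧-homo-*)
  open SemiringMult semiring using (×ᵤ≈×)
  open Determinants commutativeRing using (ε)
  open SkewSchur commutativeRing using (coefficient; schur)
  open import Relation.Binary.Reasoning.Setoid setoid

  fromℤ-⟦⟧ : ∀ i → fromℤ F i ≈ ⟦ i ⟧
  fromℤ-⟦⟧ (+ n)    = ×ᵤ≈× n 1#
  fromℤ-⟦⟧ -[1+ n ] = -‿cong (×ᵤ≈× (suc n) 1#)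

  eval-≋ : ∀ {X} (z : X → Carrier) {f g} → f ≋ g → eval F z f ≈ eval F z g
  eval-≋ z ≋-refl               = refl
  eval-≋ z (≋-sym f≋g)          = sym (eval-≋ z f≋g)
  eval-≋ z (≋-trans f≋g g≋k)    = trans (eval-≋ z f≋g) (eval-≋ z g≋k)
  eval-≋ z (:+-cong f≋ g≋)      = +-cong (eval-≋ z f≋) (eval-≋ z g≋)
  eval-≋ z (:*-cong f≋ g≋)      = *-cong (eval-≋ z f≋) (eval-≋ z g≋)
  eval-≋ z (:--cong f≋)         = -‿cong (eval-≋ z f≋)
  eval-≋ z (:+-assoc f g k)     = +-assoc _ _ _
  eval-≋ z (:+-comm f g)        = +-comm _ _
  eval-≋ z (:+-identityˡ f)     = +-identityˡ _
  eval-≋ z (:--inverseˡ f)      = -‿inverseˡ _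
  eval-≋ z (:*-assoc f g k)     = *-assoc _ _ _
  eval-≋ z (:*-comm f g)        = *-comm _ _
  eval-≋ z (:*-identityˡ f)     = trans (*-congʳ (fromℤ-⟦⟧ 1ℤ)) (*-identityˡ _)
  eval-≋ z (:*-distribˡ f g k)  = distribˡ _ _ _
  eval-≋ z (con-+ m n)          = begin
    fromℤ F (m ℤ.+ n)       ≈⟨ fromℤ-⟦⟧ (m ℤ.+ n) ⟩
    ⟦ m ℤ.+ n ⟧             ≈⟨ ⟦⟧-homo-+ m n ⟩
    ⟦ m ⟧ + ⟦ n ⟧           ≈⟨ +-cong (fromℤ-⟦⟧ m) (fromℤ-⟦⟧ n) ⟨
    fromℤ F m + fromℤ F n   ∎
  eval-≋ z (con-* m n)          = begin
    fromℤ F (m ℤ.* n)       ≈⟨ fromℤ-⟦⟧ (m ℤ.* n) ⟩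
    ⟦ m ℤ.* n ⟧             ≈⟨ ⟦⟧-homo-* m n ⟩
    ⟦ m ⟧ * ⟦ n ⟧           ≈⟨ *-cong (fromℤ-⟦⟧ m) (fromℤ-⟦⟧ n) ⟨
    fromℤ F m * fromℤ F n   ∎

  eval-rename : ∀ {X Z} (ρ : X → Z) (z : Z → Carrier) f → eval F z (rename ρ f) ≡ eval F (z ∘ ρ) f
  eval-rename ρ z (con c)  = ≡.refl
  eval-rename ρ z (var x)  = ≡.refl
  eval-rename ρ z (f :+ g) = ≡.cong₂ _+_ (eval-rename ρ z f) (eval-rename ρ z g)
  eval-rename ρ z (f :* g) = ≡.cong₂ _*_ (eval-rename ρ z f) (eval-rename ρ z g)
  eval-rename ρ z (:- f)   = ≡.cong -_ (eval-rename ρ z f)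

  eval-cong : ∀ {X} {z w : X → Carrier} → (∀ x → z x ≈ w x) → ∀ f → eval F z f ≈ eval F w f
  eval-cong z≈w (con c)  = refl
  eval-cong z≈w (var x)  = z≈w x
  eval-cong z≈w (f :+ g) = +-cong (eval-cong z≈w f) (eval-cong z≈w g)
  eval-cong z≈w (f :* g) = *-cong (eval-cong z≈w f) (eval-cong z≈w g)
  eval-cong z≈w (:- f)   = -‿cong (eval-cong z≈w f)

  eval-h : ∀ z i → eval F z (h i) ≈ coefficient z i
  eval-h z (+ zero)  = fromℤ-⟦⟧ 1ℤ
  eval-h z (+ suc n) = refl
  eval-h z -[1+ n ]  = refl

  module _ {X : Set} (z : X → Carrier) where
    module Sum = SemiringSum semiring
    module Polynomials = RawSemiringDefinitions (Semiring.rawSemiring (CommutativeRing.semiring (polyRing X)))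
    module Scalars = RawSemiringDefinitions (Semiring.rawSemiring semiring)

    eval-sum : ∀ {n} (f : Fin n → Poly X) → eval F z (Polynomials.sum f) ≈ Sum.sum (eval F z ∘ f)
    eval-sum {zero}  f = refl
    eval-sum {suc n} f = +-congˡ (eval-sum (f ∘ suc))

    eval-sign : ∀ n → eval F z ((:- con 1ℤ) Polynomials.^ n) ≈ (- 1#) Scalars.^ n
    eval-sign zero    = fromℤ-⟦⟧ 1ℤ
    eval-sign (suc n) = *-cong (-‿cong (fromℤ-⟦⟧ 1ℤ)) (eval-sign n)

    eval-det : ∀ {n} (A : Fin n → Fin n → Poly X) →
               eval F z (det (polyRing X) A) ≈ det commutativeRing (λ i j → eval F z (A i j))
    eval-det {zero}  A = fromℤ-⟦⟧ 1ℤ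
    eval-det {suc n} A = trans (eval-sum {suc n} (λ j → (:- con 1ℤ) Polynomials.^ toℕ j :* (A zero j :* det (polyRing X) (λ i k → A (suc i) (punchIn j k))))) (Sum.sum-cong-≋ {suc n} (λ j →
      *-cong (eval-sign (toℕ j)) (*-congˡ {eval F z (A zero j)} (eval-det (λ i k → A (suc i) (punchIn j k))))))

  det-cong : ∀ {n} {A B : Fin n → Fin n → Carrier} → (∀ i j → A i j ≈ B i j) →
             det commutativeRing A ≈ det commutativeRing B
  det-cong {zero}  A≈B = refl
  det-cong {suc n} A≈B = SemiringSum.sum-cong-≋ semiring {suc n} (λ j →
    *-congˡ {ε (toℕ j)} (*-cong (A≈B zero j) (det-cong (λ i k → A≈B (suc i) (punchIn j k)))))

  eval-s : ∀ z θ → eval F z (s θ) ≈ schur z θ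
  eval-s z θ = trans (eval-det z (λ i j → h (entry i j))) (det-cong (λ i j → eval-h z (entry i j)))
    where
    entry : Fin (ℓ (outer θ)) → Fin (ℓ (outer θ)) → ℤ
    entry i j = + part (outer θ) (toℕ i) ℤ.- + part (inner θ) (toℕ j) ℤ.- + toℕ i ℤ.+ + toℕ j

-- Comparison of the two counts.

theorem4p1 : ∀ {q c l} (F : FiniteField q c l) (θ : SkewPartition) (a : FiniteField.Carrier F)
    (M N : ℕ) (s∈ : s θ ∈ℤ[h₁⋯h M ]) (sᵗ∈ : s (θ ᵗˢ) ∈ℤ[h₁⋯h N ]) →
    P F (s θ) M s∈ a ≡ P F (s (θ ᵗˢ)) N sᵗ∈ a
theorem4p1 {q} F θ a M N (f , f≋s) (g , g≋sᵗ) =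
  -- After cross-multiplication both sides count points with `M + N` coordinates, each extra free
  -- coordinate contributing a factor q.
  /-cong {# f} {q ℕ.^ M} {# g} {q ℕ.^ N} {{m^n≢0 q M {{q≢0}}}} {{m^n≢0 q N {{q≢0}}}} (begin
    # f ℕ.* q ℕ.^ N
      ≡⟨ ≡.cong (ℕ._* q ℕ.^ N) (count f) ⟩
    total M (hits f) ℕ.* q ℕ.^ N
      ≡⟨ total-extend M N (hits-dependsOn f) ⟨
    total (M ℕ.+ N) (hits f)
      ≡⟨ total-cong (M ℕ.+ N) hits-elementary ⟩
    total (M ℕ.+ N) (hits g ∘ run [] (1# ∷ []))
      ≡⟨ ≡.cong (λ L → total L (hits g ∘ run [] (1# ∷ []))) (ℕ.+-comm M N) ⟩
    total (N ℕ.+ M) (hits g ∘ run [] (1# ∷ []))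
      ≡⟨ total-run (N ℕ.+ M) [] (1# ∷ [])
           (λ z w z≈w → hits-dependsOn g z w (λ i<N → z≈w (≤-trans i<N (m≤m+n N M)))) ⟩
    total (N ℕ.+ M) (hits g)
      ≡⟨ total-extend N M (hits-dependsOn g) ⟩
    total N (hits g) ℕ.* q ℕ.^ M
      ≡⟨ ≡.cong (ℕ._* q ℕ.^ M) (count g) ⟨
    # g ℕ.* q ℕ.^ M ∎)
  where
  open FiniteField F hiding (zero)
  open Counting F
  open Evaluation F
  open ElementarySequence commutativeRing
  open SkewSchur commutativeRing
  open ≡.≡-Reasoning

  #_ : ∀ {L} → Poly (Fin L) → ℕ
  #_ {L} k = length (filter (λ xs → eval F (lookup xs) k ≟ a) (points F L))

  hits : ∀ {L} → Poly (Fin L) → (ℕ → Carrier) → ℕ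
  hits k z = indicator (eval F (z ∘ toℕ) k ≟ a)

  indicator-cong : ∀ {x y} → x ≈ y → indicator (x ≟ a) ≡ indicator (y ≟ a)
  indicator-cong x≈y = indicator-⇔ (_ ≟ a) (_ ≟ a) (trans (sym x≈y)) (trans x≈y)

  hits-dependsOn : ∀ {L} (k : Poly (Fin L)) → DependsOn L (hits k)
  hits-dependsOn k z w z≈w = indicator-cong (eval-cong (λ i → z≈w (toℕ<n i)) k)

  count : ∀ {L} (k : Poly (Fin L)) →
          # k ≡ total L (hits k)
  count {L} k = length-filter-points L (λ xs → eval F (lookup xs) k ≟ a) (hits k)
    (λ xs → indicator-cong (eval-cong (λ i → reflexive (lookup-extend xs i)) k))

  eval-schur : ∀ {L} (k : Poly (Fin L)) σ → rename toℕ k ≋ s σ → ∀ z → eval F (z ∘ toℕ) k ≈ schur z σ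
  eval-schur k σ k≋s z = trans (reflexive (≡.sym (eval-rename toℕ z k))) (trans (eval-≋ z k≋s) (eval-s z σ))

  -- The representatives live in different polynomial rings, but on a whole sequence each takes the
  -- value of its Schur function, where `schur-ᵗ` applies pointwise.
  hits-elementary : ∀ z → hits f z ≡ hits g (run [] (1# ∷ []) z)
  hits-elementary z = indicator-cong (trans (eval-schur f θ f≋s z)
    (trans (schur-ᵗ θ z (elementary z) (elementary-inverse z))
      (trans (sym (eval-schur g (θ ᵗˢ) g≋sᵗ (elementary z)))
        (eval-cong (λ i → reflexive (≡.sym (run-elementary z 0 z (λ _ → ≡.refl) (toℕ i)))) g))))
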